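{- Let $(\mathcal F,\mathcal R)$ be a (completed) AFS. If $\mathcal R$ is non-terminating, then there is a minimal dependency chain over $DP(\mathcal R)$.
   Context: **Types and terms.** Simple types are built from a set of base types with the right-associative constructor $\Rightarrow$; a type is functional if it contains $\Rightarrow$. A type declaration is an expression $[\sigma_1\times\dots\times\sigma_n]\Rightarrow\tau$, $n\ge 0$ (just $\tau$ if $n=0$). There are infinitely many variables of each type; function symbols (disjoint from variables) each carry a type declaration. Terms over a set of function symbols are: variables $x:\sigma$; applications $s\cdot t:\tau$ for $s:\sigma\Rightarrow\tau$, $t:\sigma$ (left-associative); abstractions $\lambda x.s:\sigma\Rightarrow\tau$ for $x:\sigma$, $s:\tau$; functional terms $f(s_1,\dots,s_n):\tau$ for $f:[\sigma_1\times\dots\times\sigma_n]\Rightarrow\tau$, $s_i:\sigma_i$ ($\tau$ may be functional). Terms are modulo $\alpha$-conversion; $FV(s)$ is the set of free variables. $\mathrm{head}(s\cdot t)=\mathrm{head}(s)$ and $\mathrm{head}(s)=s$ for non-applications. Substitutions are type-preserving with finite domain, applied capture-avoidingly, written $s\gamma$. A context $C[]$ is a term with one hole; filling it may capture variables. $s\unrhd t$ iff $s=C[t]$ for some $C$; $s\rhd t$ iff moreover $C$ is not just the hole. **Rewriting.** A rewrite rule over $\mathcal F$ is a pair $l\to r$ of terms over $\mathcal F$ of the same type with $FV(r)\subseteq FV(l)$, where $l=f(l_1,\dots,l_n)\cdot l_{n+1}\cdots l_m$ ($m\ge n\ge 0$), and neither $l$ nor $r$ has a subterm of the form $(\lambda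 x.s)\cdot t$. An AFS (algebraic functional system) is a pair $(\mathcal F,\mathcal R)$ with $\mathcal R$ a finite set of rules over $\mathcal F$. $\to_{\mathcal R}$ is generated by $C[l\gamma]\to_{\mathcal R} C[r\gamma]$ for $l\to r\in\mathcal R$, and $C[(\lambda x.s)\cdot t]\to_{\mathcal R} C[s[x:=t]]$. A term is terminating if every reduction sequence from it is finite; an AFS is terminating if all its terms are. $f$ is a defined symbol if some rule has left-hand side $f(l_1,\dots,l_n)\cdot l_{n+1}\cdots l_m$; $\mathcal D$ is the set of defined symbols. **Completion.** AFSs are assumed completed: for each rule $l\to\lambda x_1\dots x_n.r$ with $r$ not an abstraction, the rules $l\cdot x_1\to\lambda x_2\dots x_n.r,\ \dots,\ l\cdot x_1\cdots x_n\to r$ are also in $\mathcal R$. **Dependency pairs.** For each type $\sigma$ there is a fresh constant $\mathsf c_\sigma:\sigma$; for each $f\in\mathcal D$ a fresh marked symbol $f^\sharp$ with the same declaration. $\mathcal F^\sharp_c$ is $\mathcal F$ extended with all $f^\sharp$ and all $\mathsf c_\sigma$. $s^\sharp$ is $f^\sharp(s_1,\dots,s_n)$ if $s=f(s_1,\dots,s_n)$ with $f\in\mathcal D$, and $s^\sharp=s$ otherwise (applications are not marked). A candidate term of $r$ is a subterm $t$ of $r$ of the form $f(t_1,\dots,t_m)\cdot t_{m+1}\cdots t_n$ with $f\in\mathcal D$, $n\ge m\ge 0$, or $x\cdot t_1\cdots t_n$ with $x$ free in $r$ and $n>0$. The closed candidate terms $Cand(r)$ are obtained from the candidate terms $t$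 by replacing each variable $x:\sigma$ which is bound in $r$ but free in $t$ by $\mathsf c_\sigma$. $DP(l\to r)$ consists of (i) all pairs $l^\sharp\leadsto p^\sharp$ with $p\in Cand(r)$ not a strict subterm of $l$; and (ii) if $l$ has type $\sigma_1\Rightarrow\dots\Rightarrow\sigma_n\Rightarrow\iota$ ($n\ge1$, $\iota$ a base type) and $\mathrm{head}(r)$ is a variable or a term $f(\vec s)$ with $f\in\mathcal D$: all pairs $l\cdot y_1\cdots y_k\leadsto r\cdot y_1\cdots y_k$ with $1\le k\le n$ and fresh variables $y_i$. $DP(\mathcal R)$ is the union over all rules of $\mathcal R$. **Dependency chains.** A dependency chain is an infinite sequence $[(\rho_i,s_i,t_i)\mid i\in\mathbb N]$ (terms over $\mathcal F^\sharp_c$) such that for all $i$: (1) $\rho_i\in DP(\mathcal R)\cup\{\mathtt{beta}\}$; (2) if $\rho_i=l_i\leadsto p_i$ then $s_i=l_i\gamma$, $t_i=p_i\gamma$ for some substitution $\gamma$; (3) if $\rho_i=\mathtt{beta}$ then $s_i=(\lambda x.u)\cdot v\cdot w_1\cdots w_k$ and either (a) $k>0$ and $t_i=u[x:=v]\cdot w_1\cdots w_k$, or (b) $k=0$ and $t_i=w^\sharp[x:=v]$ for some term $w\ne x$ with $u\unrhd w$ and $x\in FV(w)$; (4) $t_i\to_{in}^* s_{i+1}$, where $\to_{in}$ rewrites (with $\to_{\mathcal R}$) some $u_j$ inside a term $f(u_1,\dots,u_n)\cdot u_{n+1}\cdots u_m$ (and $\to^*_{in}$ is reflexive on all terms). The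 chain is minimal if all strict subterms of each $t_i$ are terminating under $\to_{\mathcal R}$. -}

module Defs where

open import Data.List.Base using (List; []; _∷_; _ʳ++_; map)
open import Data.List.Membership.Propositional using (_∈_; _∉_)
open import Data.List.Relation.Unary.All using (All; []; _∷_)
open import Data.List.Relation.Unary.Any using (Any)
open import Data.Nat.Base using (ℕ; zero; suc)
open import Data.Product.Base using (Σ; ∃; ∃₂; _×_; _,_)
open import Function.Base using (flip)
open import Induction.InfiniteDescent using (InfiniteDescendingSequenceFrom)
open import Relation.Binary.Construct.Closure.ReflexiveTransitive using (Star)
open import Relation.Binary.PropositionalEquality.Core using (_≡_)
open import Relation.Nullary.Negation.Core using (¬_)

infixr 7 _⇒_
infixl 7 _·_ _··_
infix  8 _⟨_⟩ _[_]
infix  4 _⊵[_]_ _▷[_]_ _∈FV_ _∈FVs_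

data Ty (B : Set) : Set where
  base : B → Ty B
  _⇒_  : Ty B → Ty B → Ty B

Ctx : Set → Set
Ctx B = List (Ty B)

-- F σs τ is the set of function symbols with declaration [σ₁ × … × σₙ] ⇒ τ.
Signature : Set → Set₁
Signature B = List (Ty B) → Ty B → Set

variable
  B         : Set
  F         : Signature B
  σ τ τ′ ρ  : Ty B
  σs τs     : List (Ty B)
  Γ Δ Θ     : Ctx B

-- Variables are de Bruijn indices on top of an infinite supply of named
-- variables: already the empty context has a variable `free n` of type σ for
-- every n and every σ.  Terms in context [] are thus the terms of the calculus
-- (modulo α); a non-empty context lists the variables whose binders have been
-- removed by passing to a subterm, which are then just further free variables.
data Var {B : Set} : Ctx B → Ty B → Set where
  free : ℕ → Var [] σ
  zero : Var (σ ∷ Γ) σ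
  suc  : Var Γ σ → Var (τ ∷ Γ) σ

data Term {B : Set} (F : Signature B) (Γ : Ctx B) : Ty B → Set where
  var : Var Γ σ → Term F Γ σ
  _·_ : Term F Γ (σ ⇒ τ) → Term F Γ σ → Term F Γ τ
  lam : Term F (σ ∷ Γ) τ → Term F Γ (σ ⇒ τ)
  fun : F σs τ → All (Term F Γ) σs → Term F Γ τ

------------------------------------------------------------------------
-- Renaming and substitution

Ren : Ctx B → Ctx B → Set
Ren Γ Δ = ∀ {σ} → Var Γ σ → Var Δ σ

Sub : Signature B → Ctx B → Ctx B → Set
Sub F Γ Δ = ∀ {σ} → Var Γ σ → Term F Δ σ

liftRen : Ren Γ Δ → Ren (τ ∷ Γ) (τ ∷ Δ)
liftRen r zero    = zero
liftRen r (suc x) = suc (r x)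

rename  : Ren Γ Δ → Term F Γ σ → Term F Δ σ
renames : Ren Γ Δ → All (Term F Γ) σs → All (Term F Δ) σs
rename r (var x)    = var (r x)
rename r (s · t)    = rename r s · rename r t
rename r (lam s)    = lam (rename (liftRen r) s)
rename r (fun f ts) = fun f (renames r ts)
renames r []       = []
renames r (t ∷ ts) = rename r t ∷ renames r ts

liftSub : Sub F Γ Δ → Sub F (τ ∷ Γ) (τ ∷ Δ)
liftSub s zero    = var zero
liftSub s (suc x) = rename suc (s x)

_⟨_⟩ : Term F Γ σ → Sub F Γ Δ → Term F Δ σ
substs : Sub F Γ Δ → All (Term F Γ) σs → All (Term F Δ) σs
var x    ⟨ γ ⟩ = γ x
(s · t)  ⟨ γ ⟩ = (s ⟨ γ ⟩) · (t ⟨ γ ⟩)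
lam s    ⟨ γ ⟩ = lam (s ⟨ liftSub γ ⟩)
fun f ts ⟨ γ ⟩ = fun f (substs γ ts)
substs γ []       = []
substs γ (t ∷ ts) = (t ⟨ γ ⟩) ∷ substs γ ts

single : Term F Γ σ → Sub F (σ ∷ Γ) Γ
single v zero    = v
single v (suc x) = var x

_[_] : Term F (σ ∷ Γ) τ → Term F Γ σ → Term F Γ τ
u [ v ] = u ⟨ single v ⟩

-- Passing below the binders Θ (outermost first) turns context Γ into Θ ʳ++ Γ.
wkBelow : ∀ Θ → Ren Γ (Θ ʳ++ Γ)
wkBelow []      x = x
wkBelow (_ ∷ Θ) x = wkBelow Θ (suc x)

liftBelow : ∀ Θ → Sub F Γ Δ → Sub F (Θ ʳ++ Γ) (Θ ʳ++ Δ)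
liftBelow []      γ = γ
liftBelow (_ ∷ Θ) γ = liftBelow Θ (liftSub γ)

named : ∀ Γ → Ren {B} [] Γ
named []      x = x
named (_ ∷ Γ) x = suc (named Γ x)

-- Substitutions for the named variables, with finite domain {x | xγ ≠ x}.
record Subst {B : Set} (F : Signature B) (Γ : Ctx B) : Set where
  field
    app    : Sub F [] Γ
    dom    : List (∃ (Var {B} []))
    finite : ∀ {σ} (x : Var [] σ) → (σ , x) ∉ dom → app x ≡ var (named Γ x)

data _∈FV_  {B : Set} {F : Signature B} {Γ : Ctx B} {τ : Ty B} (x : Var Γ τ) :
            {σ : Ty B} → Term F Γ σ → Set
data _∈FVs_ {B : Set} {F : Signature B} {Γ : Ctx B} {τ : Ty B} (x : Var Γ τ) :
            {σs : List (Ty B)} → All (Term F Γ) σs → Set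

data _∈FV_ {B} {F} {Γ} {τ} x where
  var  : x ∈FV var x
  appˡ : {s : Term F Γ (σ ⇒ ρ)} {t : Term F Γ σ} → x ∈FV s → x ∈FV s · t
  appʳ : {s : Term F Γ (σ ⇒ ρ)} {t : Term F Γ σ} → x ∈FV t → x ∈FV s · t
  lam  : {s : Term F (σ ∷ Γ) ρ} → suc x ∈FV s → x ∈FV lam s
  fun  : {f : F σs ρ} {ts : All (Term F Γ) σs} → x ∈FVs ts → x ∈FV fun f ts

data _∈FVs_ {B} {F} {Γ} {τ} x where
  here  : {t : Term F Γ σ} {ts : All (Term F Γ) σs} → x ∈FV t → x ∈FVs (t ∷ ts)
  there : {t : Term F Γ σ} {ts : All (Term F Γ) σs} → x ∈FVs ts → x ∈FVs (t ∷ ts)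

------------------------------------------------------------------------
-- Shapes of terms

data Spine {B : Set} (F : Signature B) (Γ : Ctx B) : Ty B → Ty B → Set where
  []  : Spine F Γ σ σ
  _∷_ : Term F Γ σ → Spine F Γ τ ρ → Spine F Γ (σ ⇒ τ) ρ

_··_ : Term F Γ σ → Spine F Γ σ τ → Term F Γ τ
s ·· []       = s
s ·· (t ∷ ts) = (s · t) ·· ts

-- HeadSym f s: s has the form f(s₁,…,sₙ) · sₙ₊₁ ⋯ sₘ with m ≥ n.
data HeadSym {B : Set} {F : Signature B} {Γ : Ctx B} {σs : List (Ty B)} {τ : Ty B}
             (f : F σs τ) : {σ : Ty B} → Term F Γ σ → Set where
  fun : (ts : All (Term F Γ) σs) → HeadSym f (fun f ts)
  app : {s : Term F Γ (σ ⇒ ρ)} {t : Term F Γ σ} → HeadSym f s → HeadSym f (s · t)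

-- HeadVar x s: s has the form x · s₁ ⋯ sₙ with n ≥ 0.
data HeadVar {B : Set} {F : Signature B} {Γ : Ctx B} {τ : Ty B} (x : Var Γ τ) :
             {σ : Ty B} → Term F Γ σ → Set where
  var : HeadVar x (var x)
  app : {s : Term F Γ (σ ⇒ ρ)} {t : Term F Γ σ} → HeadVar x s → HeadVar x (s · t)

data IsVar {B : Set} {F : Signature B} {Γ : Ctx B} {τ : Ty B} (x : Var Γ τ) :
           {σ : Ty B} → Term F Γ σ → Set where
  var : IsVar x (var x)

data IsLam {B : Set} {F : Signature B} {Γ : Ctx B} :
           {σ : Ty B} → Term F Γ σ → Set where
  lam : (s : Term F (σ ∷ Γ) τ) → IsLam (lam s)

------------------------------------------------------------------------
-- Contexts with one hole

-- Cxt F Θ τ Γ σ: a term of type σ in context Γ with one hole of type τ lying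
-- below the binders Θ; plugging a term into the hole captures Θ.
data Cxt     {B : Set} (F : Signature B) : (Θ : Ctx B) (τ : Ty B) (Γ : Ctx B) → Ty B → Set
data CxtArgs {B : Set} (F : Signature B) : (Θ : Ctx B) (τ : Ty B) (Γ : Ctx B) → List (Ty B) → Set

data Cxt F where
  □    : Cxt F [] σ Γ σ
  appˡ : Cxt F Θ τ Γ (σ ⇒ ρ) → Term F Γ σ → Cxt F Θ τ Γ ρ
  appʳ : Term F Γ (σ ⇒ ρ) → Cxt F Θ τ Γ σ → Cxt F Θ τ Γ ρ
  lam  : Cxt F Θ τ (σ ∷ Γ) ρ → Cxt F (σ ∷ Θ) τ Γ (σ ⇒ ρ)
  fun  : F σs σ → CxtArgs F Θ τ Γ σs → Cxt F Θ τ Γ σ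

data CxtArgs F where
  here  : Cxt F Θ τ Γ σ → All (Term F Γ) σs → CxtArgs F Θ τ Γ (σ ∷ σs)
  there : Term F Γ σ → CxtArgs F Θ τ Γ σs → CxtArgs F Θ τ Γ (σ ∷ σs)

plug     : Cxt F Θ τ Γ σ → Term F (Θ ʳ++ Γ) τ → Term F Γ σ
plugArgs : CxtArgs F Θ τ Γ σs → Term F (Θ ʳ++ Γ) τ → All (Term F Γ) σs
plug □          u = u
plug (appˡ C t) u = plug C u · t
plug (appʳ s C) u = s · plug C u
plug (lam C)    u = lam (plug C u)
plug (fun f C)  u = fun f (plugArgs C u)
plugArgs (here C ts) u = plug C u ∷ ts
plugArgs (there t C) u = t ∷ plugArgs C u

data IsHole {B : Set} {F : Signature B} :
            {Θ : Ctx B} {τ : Ty B} {Γ : Ctx B} {σ : Ty B} → Cxt F Θ τ Γ σ → Set where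
  □ : IsHole (□ {σ = σ} {Γ = Γ})

-- Θ lists the binders of s above the subterm occurrence t.
_⊵[_]_ : Term F Γ σ → (Θ : Ctx B) → Term F (Θ ʳ++ Γ) τ → Set
_⊵[_]_ {F = F} {Γ = Γ} {σ = σ} {τ = τ} s Θ t =
  Σ (Cxt F Θ τ Γ σ) λ C → s ≡ plug C t

_▷[_]_ : Term F Γ σ → (Θ : Ctx B) → Term F (Θ ʳ++ Γ) τ → Set
_▷[_]_ {F = F} {Γ = Γ} {σ = σ} {τ = τ} s Θ t =
  Σ (Cxt F Θ τ Γ σ) λ C → (¬ IsHole C) × s ≡ plug C t

------------------------------------------------------------------------
-- Rewriting

record Rule {B : Set} (F : Signature B) : Set where
  constructor rule
  field
    {type} : Ty B
    lhs    : Term F [] type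
    rhs    : Term F [] type

open Rule public

BetaFree : {B : Set} {F : Signature B} {Γ : Ctx B} {ρ : Ty B} → Term F Γ ρ → Set
BetaFree {B} {F} {Γ} t =
  ∀ (Θ : Ctx B) {σ τ : Ty B} (s : Term F (σ ∷ (Θ ʳ++ Γ)) τ) (u : Term F (Θ ʳ++ Γ) σ) →
  ¬ (t ⊵[ Θ ] (lam s · u))

record IsRule {B : Set} {F : Signature B} (ℓ : Rule F) : Set where
  field
    headed : ∃₂ λ σs τ → Σ (F σs τ) λ f → HeadSym f (lhs ℓ)
    vars   : ∀ {τ} (x : Var [] τ) → x ∈FV rhs ℓ → x ∈FV lhs ℓ
    lhs-βf : BetaFree (lhs ℓ)
    rhs-βf : BetaFree (rhs ℓ)

data Redex {B : Set} {F : Signature B} (R : List (Rule F)) {Γ : Ctx B} :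
           {σ : Ty B} → Term F Γ σ → Term F Γ σ → Set where
  rule : {l r : Term F [] σ} → rule l r ∈ R → (γ : Subst F Γ) →
         Redex R (l ⟨ Subst.app γ ⟩) (r ⟨ Subst.app γ ⟩)
  beta : (s : Term F (σ ∷ Γ) τ) (t : Term F Γ σ) → Redex R (lam s · t) (s [ t ])

data Step {B : Set} {F : Signature B} (R : List (Rule F)) {Γ : Ctx B} {σ : Ty B} :
          Term F Γ σ → Term F Γ σ → Set where
  step : (C : Cxt F Θ τ Γ σ) {u v : Term F (Θ ʳ++ Γ) τ} →
         Redex R u v → Step R (plug C u) (plug C v)

data StepArgs {B : Set} {F : Signature B} (R : List (Rule F)) {Γ : Ctx B} :
              {σs : List (Ty B)} → All (Term F Γ) σs → All (Term F Γ) σs → Set where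
  here  : {t t′ : Term F Γ σ} {ts : All (Term F Γ) σs} →
          Step R t t′ → StepArgs R (t ∷ ts) (t′ ∷ ts)
  there : {t : Term F Γ σ} {ts ts′ : All (Term F Γ) σs} →
          StepArgs R ts ts′ → StepArgs R (t ∷ ts) (t ∷ ts′)

-- A step inside one of the uⱼ (1 ≤ j ≤ m) of f(u₁,…,uₙ) · uₙ₊₁ ⋯ uₘ.
data StepIn {B : Set} {F : Signature B} (R : List (Rule F)) {Γ : Ctx B} :
            {σ : Ty B} → Term F Γ σ → Term F Γ σ → Set where
  fun  : {f : F σs τ} {ts ts′ : All (Term F Γ) σs} →
         StepArgs R ts ts′ → StepIn R (fun f ts) (fun f ts′)
  appˡ : {s s′ : Term F Γ (σ ⇒ τ)} {t : Term F Γ σ} →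
         StepIn R s s′ → StepIn R (s · t) (s′ · t)
  appʳ : {f : F σs ρ} {s : Term F Γ (σ ⇒ τ)} {t t′ : Term F Γ σ} →
         HeadSym f s → Step R t t′ → StepIn R (s · t) (s · t′)

TerminatingTerm : List (Rule F) → Term F Γ σ → Set
TerminatingTerm R t = ¬ ∃ λ f → InfiniteDescendingSequenceFrom (flip (Step R)) f t

record AFS (B : Set) : Set₁ where
  field
    Sym   : Signature B
    rules : List (Rule Sym)
    valid : All IsRule rules

-- Completes R l r: for r = λx₁…xₙ.r′ with r′ not an abstraction, the rules
-- l·x₁ → λx₂…xₙ.r′, …, l·x₁⋯xₙ → r′ are in R, for some choice of names xᵢ.
data Completes {B : Set} {F : Signature B} (R : List (Rule F)) :
               {σ : Ty B} → Term F [] σ → Term F [] σ → Set where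
  done : {l r : Term F [] σ} → ¬ IsLam r → Completes R l r
  next : {l : Term F [] (σ ⇒ τ)} {r : Term F (σ ∷ []) τ} (x : Var [] σ) →
         ¬ x ∈FV l → ¬ x ∈FV lam r →
         rule (l · var x) (r [ var x ]) ∈ R →
         Completes R (l · var x) (r [ var x ]) →
         Completes R l (lam r)

module _ {B : Set} (𝒜 : AFS B) where
  open AFS 𝒜

  TerminatingAFS : Set
  TerminatingAFS = ∀ {Γ σ} (t : Term Sym Γ σ) → TerminatingTerm rules t

  Completed : Set
  Completed = All (λ ℓ → Completes rules (lhs ℓ) (rhs ℓ)) rules

  Defined : Sym σs τ → Set
  Defined f = Any (λ ℓ → HeadSym f (lhs ℓ)) rules

  ----------------------------------------------------------------------
  -- Dependency pairs

  -- Irrelevance of the argument of `mark` makes f♯ unique for each f.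
  data Sym♯ : Signature B where
    orig  : Sym σs τ → Sym♯ σs τ
    mark  : (f : Sym σs τ) → .(Defined f) → Sym♯ σs τ
    const : (σ : Ty B) → Sym♯ [] σ

  embed  : Term Sym Γ σ → Term Sym♯ Γ σ
  embeds : All (Term Sym Γ) σs → All (Term Sym♯ Γ) σs
  embed (var x)    = var x
  embed (s · t)    = embed s · embed t
  embed (lam s)    = lam (embed s)
  embed (fun f ts) = fun (orig f) (embeds ts)
  embeds []       = []
  embeds (t ∷ ts) = embed t ∷ embeds ts

  rules♯ : List (Rule Sym♯)
  rules♯ = map (λ ℓ → rule (embed (lhs ℓ)) (embed (rhs ℓ))) rules

  data Markable {Γ : Ctx B} : {σ : Ty B} → Term Sym♯ Γ σ → Set where
    markable : {f : Sym σs τ} → Defined f → (ts : All (Term Sym♯ Γ) σs) →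
               Markable (fun (orig f) ts)

  -- Marked s s′: s′ = s♯.
  data Marked {Γ : Ctx B} : {σ : Ty B} → Term Sym♯ Γ σ → Term Sym♯ Γ σ → Set where
    marked   : {f : Sym σs τ} (d : Defined f) (ts : All (Term Sym♯ Γ) σs) →
               Marked (fun (orig f) ts) (fun (mark f d) ts)
    unmarked : {s : Term Sym♯ Γ σ} → ¬ Markable s → Marked s s

  -- For a subterm lying in context Γ of r, `named Γ x` is x free in r, and the
  -- other variables in Γ are the ones bound in r.
  data Candidate {Γ : Ctx B} : {σ : Ty B} → Term Sym Γ σ → Set where
    bySym : {f : Sym σs τ} {t : Term Sym Γ σ} → Defined f → HeadSym f t → Candidate t
    byVar : (x : Var [] ρ) {s : Term Sym Γ (σ ⇒ τ)} {t : Term Sym Γ σ} →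
            HeadVar (named Γ x) s → Candidate (s · t)

  close : Sub Sym♯ Γ []
  close (free n)     = var (free n)
  close (zero {σ})   = fun (const σ) []
  close (suc x)      = close x

  data Cand (r : Term Sym [] ρ) : Term Sym♯ [] σ → Set where
    cand : (Θ : Ctx B) (t : Term Sym (Θ ʳ++ []) σ) → r ⊵[ Θ ] t →
           Candidate t → Cand r (embed t ⟨ close ⟩)

  data DefinedOrVarHead {Γ : Ctx B} {σ : Ty B} (r : Term Sym Γ σ) : Set where
    bySym : {f : Sym σs τ} → Defined f → HeadSym f r → DefinedOrVarHead r
    byVar : (x : Var Γ τ) → HeadVar x r → DefinedOrVarHead r

  -- Extend l r l′ r′: l′ = l·y₁⋯yₖ and r′ = r·y₁⋯yₖ with k ≥ 1 and fresh yᵢ;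
  -- typing bounds k by the number of arguments of the type of l.
  data Extend : {σ τ : Ty B} → Term Sym [] σ → Term Sym [] σ →
                Term Sym [] τ → Term Sym [] τ → Set where
    one  : {l r : Term Sym [] (σ ⇒ τ)} (y : Var [] σ) → ¬ y ∈FV l → ¬ y ∈FV r →
           Extend l r (l · var y) (r · var y)
    more : {l r : Term Sym [] ρ} {l′ r′ : Term Sym [] (σ ⇒ τ)} → Extend l r l′ r′ →
           (y : Var [] σ) → ¬ y ∈FV l′ → ¬ y ∈FV r′ →
           Extend l r (l′ · var y) (r′ · var y)

  -- "Not a strict subterm of l" is read without capture: the free variables of
  -- p must not become bound at the occurrence, so p is weakened below Θ.
  data DP : Term Sym♯ [] σ → Term Sym♯ [] τ → Set where
    cand   : {l r : Term Sym [] ρ} {l♯ : Term Sym♯ [] ρ} {p p♯ : Term Sym♯ [] τ} →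
             rule l r ∈ rules → Cand r p →
             (∀ Θ → ¬ (embed l ▷[ Θ ] rename (wkBelow Θ) p)) →
             Marked (embed l) l♯ → Marked p p♯ → DP l♯ p♯
    extend : {l r : Term Sym [] ρ} {l′ r′ : Term Sym [] σ} →
             rule l r ∈ rules → DefinedOrVarHead r →
             Extend l r l′ r′ → DP (embed l′) (embed r′)

  ----------------------------------------------------------------------
  -- Dependency chains

  data Label : Set where
    dp   : {l : Term Sym♯ [] σ} {p : Term Sym♯ [] τ} → DP l p → Label
    beta : Label

  -- In beta-sub, x is the variable `zero` of u, i.e. `wkBelow Θ zero` in w.
  -- The bound variables Θ of u remain as free variables of the result.
  data ChainStep {Γ : Ctx B} {σ : Ty B} :
                 Label → Term Sym♯ Γ σ → {Δ : Ctx B} {τ : Ty B} → Term Sym♯ Δ τ → Set where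
    pair     : {l : Term Sym♯ [] σ} {p : Term Sym♯ [] τ} (d : DP l p) (γ : Subst Sym♯ Γ) →
               ChainStep (dp d) (l ⟨ Subst.app γ ⟩) (p ⟨ Subst.app γ ⟩)
    beta-app : (u : Term Sym♯ (ρ ∷ Γ) (τ ⇒ τ′)) (v : Term Sym♯ Γ ρ)
               (w : Term Sym♯ Γ τ) (ws : Spine Sym♯ Γ τ′ σ) →
               ChainStep beta ((lam u · v) ·· (w ∷ ws)) (u [ v ] ·· (w ∷ ws))
    beta-sub : (u : Term Sym♯ (ρ ∷ Γ) σ) (v : Term Sym♯ Γ ρ) (Θ : Ctx B)
               {w w♯ : Term Sym♯ (Θ ʳ++ (ρ ∷ Γ)) τ} →
               u ⊵[ Θ ] w → wkBelow Θ zero ∈FV w →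
               ¬ IsVar (wkBelow Θ zero) w →
               Marked w w♯ →
               ChainStep beta (lam u · v) (w♯ ⟨ liftBelow Θ (single v) ⟩)

  record DependencyChain : Set where
    field
      label : ℕ → Label
      ctx   : ℕ → Ctx B
      type  : ℕ → Ty B
      s     : ∀ i → Term Sym♯ (ctx i) (type i)
      t     : ∀ i → Term Sym♯ (ctx (suc i)) (type (suc i))
      link  : ∀ i → ChainStep (label i) (s i) (t i)
      inner : ∀ i → Star (StepIn rules♯) (t i) (s (suc i))

  Minimal : DependencyChain → Set
  Minimal c = ∀ i (Θ : Ctx B) {τ} (u : Term Sym♯ (Θ ʳ++ ctx (suc i)) τ) →
              t i ▷[ Θ ] u → TerminatingTerm rules♯ u
    where open DependencyChain c

{-# OPTIONS --safe #-}

-- A non-terminating term has a minimal non-terminating subterm q, and q♯ starts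
-- the chain.  If q = (λx.u) · v · w⃗, its head β-reduct is still non-terminating:
-- either it is applied, and then again minimal, or the chain continues with a
-- minimal subterm w of u such that w[x := v] does not terminate.  Otherwise q is
-- headed by a function symbol; as its arguments terminate, finitely many inner
-- steps lead to a head step lγ · w⃗ → rγ · w⃗ with non-terminating result.  For
-- empty w⃗ a minimal subterm of r with non-terminating closed instance is a
-- candidate; for non-empty w⃗ completion makes the rules for l · x₁ ⋯ xₖ available
-- until r is not an abstraction, and then a pair l · y⃗ ↝ r · y⃗ applies.
-- Excluded middle over Set returns witnesses, so it provides all the choices
-- made in the infinite iteration.
module Submission where

open import Defs
open import Axiom.ExcludedMiddle using (ExcludedMiddle)
open import Data.Empty using (⊥; ⊥-elim)
open import Data.List.Base using (List; []; _∷_; _++_; _ʳ++_; map)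
open import Data.List.Membership.Propositional using (_∈_; _∉_; lose)
open import Data.List.Membership.Propositional.Properties using (∈-++⁺ˡ; ∈-++⁺ʳ; ∈-map⁺; ∈-map⁻)
open import Data.List.Relation.Unary.All as All using (All; []; _∷_)
open import Data.List.Relation.Unary.Any using (here; there)
open import Data.Nat.Base using (ℕ; zero; suc; _≤_)
open import Data.Nat.ListAction using (sum)
open import Data.Nat.Properties using (≤-trans; m≤m+n; m≤n+m; n≮n)
open import Data.Product.Base using (Σ; ∃; ∃₂; _×_; _,_; proj₁; proj₂)
open import Data.Sum.Base using (_⊎_; inj₁; inj₂)
open import Data.Unit.Base using (⊤; tt)
open import Function.Base using (flip; _∘_; id)
open import Induction.WellFounded using (Acc; acc)
open import Level using (0ℓ)
open import Relation.Binary.Construct.Closure.ReflexiveTransitive using (Star; ε; _◅_; _◅◅_; gmap)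
open import Relation.Binary.PropositionalEquality.Core using (_≡_; refl; sym; trans; cong; cong₂; subst; subst₂)
open import Relation.Nullary.Decidable.Core using (Dec; yes; no)
open import Relation.Nullary.Negation.Core using (¬_)

-- Substitution calculus

subst-coincide : (t : Term F Γ σ) (γ δ : Sub F Γ Δ) →
                 (∀ {τ} (x : Var Γ τ) → x ∈FV t → γ x ≡ δ x) → t ⟨ γ ⟩ ≡ t ⟨ δ ⟩
substs-coincide : (ts : All (Term F Γ) σs) (γ δ : Sub F Γ Δ) →
                  (∀ {τ} (x : Var Γ τ) → x ∈FVs ts → γ x ≡ δ x) → substs γ ts ≡ substs δ ts
subst-coincide (var x)    γ δ h = h x var
subst-coincide (s · t)    γ δ h =
  cong₂ _·_ (subst-coincide s γ δ (λ x → h x ∘ appˡ)) (subst-coincide t γ δ (λ x → h x ∘ appʳ))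
subst-coincide (lam s)    γ δ h = cong lam (subst-coincide s (liftSub γ) (liftSub δ) λ
  { zero    _ → refl
  ; (suc x) p → cong (rename suc) (h x (lam p)) })
subst-coincide (fun f ts) γ δ h = cong (fun f) (substs-coincide ts γ δ (λ x → h x ∘ fun))
substs-coincide []       γ δ h = refl
substs-coincide (t ∷ ts) γ δ h =
  cong₂ _∷_ (subst-coincide t γ δ (λ x → h x ∘ here)) (substs-coincide ts γ δ (λ x → h x ∘ there))

subst-cong : (t : Term F Γ σ) (γ δ : Sub F Γ Δ) →
             (∀ {τ} (x : Var Γ τ) → γ x ≡ δ x) → t ⟨ γ ⟩ ≡ t ⟨ δ ⟩
subst-cong t γ δ h = subst-coincide t γ δ (λ x _ → h x)

subst-id  : (t : Term F Γ σ) → t ⟨ var ⟩ ≡ t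
substs-id : (ts : All (Term F Γ) σs) → substs var ts ≡ ts
subst-id (var x)    = refl
subst-id (s · t)    = cong₂ _·_ (subst-id s) (subst-id t)
subst-id (lam s)    = cong lam (trans
  (subst-cong s (liftSub var) var λ { zero → refl ; (suc x) → refl }) (subst-id s))
subst-id (fun f ts) = cong (fun f) (substs-id ts)
substs-id []       = refl
substs-id (t ∷ ts) = cong₂ _∷_ (subst-id t) (substs-id ts)

rename-as-subst  : (t : Term F Γ σ) (r : Ren Γ Δ) → rename r t ≡ t ⟨ (λ x → var (r x)) ⟩
renames-as-subst : (ts : All (Term F Γ) σs) (r : Ren Γ Δ) → renames r ts ≡ substs (λ x → var (r x)) ts
rename-as-subst (var x)    r = refl
rename-as-subst (s · t)    r = cong₂ _·_ (rename-as-subst s r) (rename-as-subst t r)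
rename-as-subst (lam s)    r = cong lam (trans (rename-as-subst s (liftRen r))
  (subst-cong s _ _ λ { zero → refl ; (suc x) → refl }))
rename-as-subst (fun f ts) r = cong (fun f) (renames-as-subst ts r)
renames-as-subst []       r = refl
renames-as-subst (t ∷ ts) r = cong₂ _∷_ (rename-as-subst t r) (renames-as-subst ts r)

subst-rename  : (t : Term F Γ σ) (r : Ren Γ Δ) (γ : Sub F Δ Θ) →
                rename r t ⟨ γ ⟩ ≡ t ⟨ (λ x → γ (r x)) ⟩
substs-rename : (ts : All (Term F Γ) σs) (r : Ren Γ Δ) (γ : Sub F Δ Θ) →
                substs γ (renames r ts) ≡ substs (λ x → γ (r x)) ts
subst-rename (var x)    r γ = refl
subst-rename (s · t)    r γ = cong₂ _·_ (subst-rename s r γ) (subst-rename t r γ)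
subst-rename (lam s)    r γ = cong lam (trans (subst-rename s (liftRen r) (liftSub γ))
  (subst-cong s _ _ λ { zero → refl ; (suc x) → refl }))
subst-rename (fun f ts) r γ = cong (fun f) (substs-rename ts r γ)
substs-rename []       r γ = refl
substs-rename (t ∷ ts) r γ = cong₂ _∷_ (subst-rename t r γ) (substs-rename ts r γ)

rename-rename : (t : Term F Γ σ) (r : Ren Γ Δ) (r′ : Ren Δ Θ) →
                rename r′ (rename r t) ≡ rename (λ x → r′ (r x)) t
rename-rename t r r′ = trans (rename-as-subst (rename r t) r′)
  (trans (subst-rename t r _) (sym (rename-as-subst t _)))

rename-subst  : (t : Term F Γ σ) (γ : Sub F Γ Δ) (r : Ren Δ Θ) →
                rename r (t ⟨ γ ⟩) ≡ t ⟨ (λ x → rename r (γ x)) ⟩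
renames-subst : (ts : All (Term F Γ) σs) (γ : Sub F Γ Δ) (r : Ren Δ Θ) →
                renames r (substs γ ts) ≡ substs (λ x → rename r (γ x)) ts
rename-subst (var x)    γ r = refl
rename-subst (s · t)    γ r = cong₂ _·_ (rename-subst s γ r) (rename-subst t γ r)
rename-subst (lam s)    γ r = cong lam (trans (rename-subst s (liftSub γ) (liftRen r))
  (subst-cong s _ _ λ
    { zero    → refl
    ; (suc x) → trans (rename-rename (γ x) suc (liftRen r)) (sym (rename-rename (γ x) r suc)) }))
rename-subst (fun f ts) γ r = cong (fun f) (renames-subst ts γ r)
renames-subst []       γ r = refl
renames-subst (t ∷ ts) γ r = cong₂ _∷_ (rename-subst t γ r) (renames-subst ts γ r)

lift-subst : (γ : Sub F Γ Δ) (δ : Sub F Δ Θ) (x : Var (τ ∷ Γ) σ) →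
             liftSub γ x ⟨ liftSub δ ⟩ ≡ liftSub (λ y → γ y ⟨ δ ⟩) x
lift-subst γ δ zero    = refl
lift-subst γ δ (suc x) = trans (subst-rename (γ x) suc (liftSub δ)) (sym (rename-subst (γ x) δ suc))

subst-subst  : (t : Term F Γ σ) (γ : Sub F Γ Δ) (δ : Sub F Δ Θ) →
               t ⟨ γ ⟩ ⟨ δ ⟩ ≡ t ⟨ (λ x → γ x ⟨ δ ⟩) ⟩
substs-subst : (ts : All (Term F Γ) σs) (γ : Sub F Γ Δ) (δ : Sub F Δ Θ) →
               substs δ (substs γ ts) ≡ substs (λ x → γ x ⟨ δ ⟩) ts
subst-subst (var x)    γ δ = refl
subst-subst (s · t)    γ δ = cong₂ _·_ (subst-subst s γ δ) (subst-subst t γ δ)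
subst-subst (lam s)    γ δ = cong lam (trans (subst-subst s (liftSub γ) (liftSub δ))
  (subst-cong s _ _ (lift-subst γ δ)))
subst-subst (fun f ts) γ δ = cong (fun f) (substs-subst ts γ δ)
substs-subst []       γ δ = refl
substs-subst (t ∷ ts) γ δ = cong₂ _∷_ (subst-subst t γ δ) (substs-subst ts γ δ)

rename-suc-single : (t : Term F Γ σ) (v : Term F Γ τ) → rename suc t [ v ] ≡ t
rename-suc-single t v = trans (subst-rename t suc (single v)) (subst-id t)

subst-single : (s : Term F (τ ∷ Γ) σ) (t : Term F Γ τ) (δ : Sub F Γ Δ) →
               s [ t ] ⟨ δ ⟩ ≡ (s ⟨ liftSub δ ⟩) [ t ⟨ δ ⟩ ]
subst-single s t δ = trans (subst-subst s (single t) δ)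
  (trans (subst-cong s _ _ λ { zero → refl ; (suc x) → sym (rename-suc-single (δ x) _) })
         (sym (subst-subst s (liftSub δ) (single (t ⟨ δ ⟩)))))

wkBelow-lift : ∀ Θ (γ : Sub F Γ Δ) (x : Var Γ σ) →
               liftBelow Θ γ (wkBelow Θ x) ≡ rename (wkBelow Θ) (γ x)
wkBelow-lift []      γ x = sym (trans (rename-as-subst (γ x) _) (subst-id (γ x)))
wkBelow-lift (τ ∷ Θ) γ x = trans (wkBelow-lift Θ (liftSub γ) (suc x)) (rename-rename (γ x) suc (wkBelow Θ))

subst-wkBelow : ∀ Θ (γ : Sub F Γ Δ) (t : Term F Γ σ) →
                rename (wkBelow Θ) t ⟨ liftBelow Θ γ ⟩ ≡ rename (wkBelow Θ) (t ⟨ γ ⟩)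
subst-wkBelow Θ γ t = trans (subst-rename t (wkBelow Θ) (liftBelow Θ γ))
  (trans (subst-cong t _ _ (wkBelow-lift Θ γ)) (sym (rename-subst t γ (wkBelow Θ))))

-- A one-sided inverse that may fail at `x` only; it recovers a term in which `x` is not free from
-- its instance under `γ`.
RetractExcept : (x : Var Γ ρ) → Sub F Γ Δ → Sub F Δ Γ → Set
RetractExcept {Γ = Γ} {ρ = ρ} x γ δ =
  ∀ {σ} (y : Var Γ σ) → ((σ , y) ≡ (ρ , x)) ⊎ (γ y ⟨ δ ⟩ ≡ var y)

retractBelow : ∀ Θ (x : Var Γ ρ) (γ : Sub F Γ Δ) (δ : Sub F Δ Γ) → RetractExcept x γ δ →
               RetractExcept (wkBelow Θ x) (liftBelow Θ γ) (liftBelow Θ δ)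
retractBelow []      x γ δ h = h
retractBelow {Γ = Γ} (τ ∷ Θ) x γ δ h = retractBelow Θ (suc x) (liftSub γ) (liftSub δ) lifted
  where
  lifted : RetractExcept (suc x) (liftSub γ) (liftSub δ)
  lifted zero    = inj₂ refl
  lifted (suc y) with h y
  ... | inj₁ refl = inj₁ refl
  ... | inj₂ eq   = inj₂ (trans (lift-subst γ δ (suc y)) (cong (rename suc) eq))

-- Named variables, freshness, finite substitutions

NamedVars : Set → Set
NamedVars B = List (∃ (Var {B} []))

name : Var {B} Γ σ → NamedVars B
name {σ = σ} (free n) = (σ , free n) ∷ []
name zero             = []
name (suc x)          = name x

name-named : ∀ Γ (x : Var [] σ) → (σ , x) ∈ name (named {B} Γ x)
name-named []      (free n) = here refl
name-named (τ ∷ Γ) x        = name-named Γ x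

-- Only named variables are collected; the variables listed in the context contribute nothing.
fvs  : Term {B} F Γ σ → NamedVars B
fvss : All (Term {B} F Γ) σs → NamedVars B
fvs (var x)    = name x
fvs (s · t)    = fvs s ++ fvs t
fvs (lam s)    = fvs s
fvs (fun f ts) = fvss ts
fvss []       = []
fvss (t ∷ ts) = fvs t ++ fvss ts

∈-fvs  : {x : Var [] τ} {t : Term F Γ σ} → named Γ x ∈FV t → (τ , x) ∈ fvs t
∈-fvss : {x : Var [] τ} {ts : All (Term F Γ) σs} → named Γ x ∈FVs ts → (τ , x) ∈ fvss ts
∈-fvs {Γ = Γ} {x = x} var = name-named Γ x
∈-fvs (appˡ p)            = ∈-++⁺ˡ (∈-fvs p)
∈-fvs (appʳ {s = s} p)    = ∈-++⁺ʳ (fvs s) (∈-fvs p)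
∈-fvs (lam p)             = ∈-fvs p
∈-fvs (fun p)             = ∈-fvss p
∈-fvss (here p)           = ∈-++⁺ˡ (∈-fvs p)
∈-fvss (there {t = t} p)  = ∈-++⁺ʳ (fvs t) (∈-fvss p)

index : ∃ (Var {B} []) → ℕ
index (_ , free n) = n

index≤sum : {x : ∃ (Var {B} [])} {xs : NamedVars B} → x ∈ xs → index x ≤ sum (map index xs)
index≤sum {xs = y ∷ xs} (here refl) = m≤m+n (index y) _
index≤sum {xs = y ∷ xs} (there p)   = ≤-trans (index≤sum p) (m≤n+m _ (index y))

fresh-name : ∀ σ (xs : NamedVars B) → Σ (Var [] σ) λ y → (σ , y) ∉ xs
-- The successor of the sum exceeds every index occurring in `xs`, whatever its type.
fresh-name σ xs = free (suc (sum (map index xs))) , λ p → n≮n _ (index≤sum p)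

fresh-var : ∀ σ (s : Term F [] τ) (t : Term F [] ρ) →
            Σ (Var [] σ) λ y → ¬ y ∈FV s × ¬ y ∈FV t
fresh-var σ s t with fresh-name σ (fvs s ++ fvs t)
... | y , y∉ = y , y∉ ∘ ∈-++⁺ˡ ∘ ∈-fvs , y∉ ∘ ∈-++⁺ʳ (fvs s) ∘ ∈-fvs

-- Spines and heads

snoc : Spine F Γ σ (τ ⇒ ρ) → Term F Γ τ → Spine F Γ σ ρ
snoc []       t = t ∷ []
snoc (s ∷ ss) t = s ∷ snoc ss t

··-snoc : (s : Term F Γ σ) (ss : Spine F Γ σ (τ ⇒ ρ)) (t : Term F Γ τ) →
          s ·· snoc ss t ≡ (s ·· ss) · t
··-snoc s []       t = refl
··-snoc s (u ∷ ss) t = ··-snoc (s · u) ss t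

headSym-·· : {f : F σs τ} {s : Term F Γ σ} (ss : Spine F Γ σ ρ) → HeadSym f s → HeadSym f (s ·· ss)
headSym-·· []       h = h
headSym-·· (_ ∷ ss) h = headSym-·· ss (app h)

headSym-subst : {f : F σs τ} {s : Term F Γ σ} (γ : Sub F Γ Δ) → HeadSym f s → HeadSym f (s ⟨ γ ⟩)
headSym-subst γ (fun ts) = fun (substs γ ts)
headSym-subst γ (app h)  = app (headSym-subst γ h)

-- The declarations of `f` and `g` are not known to agree beforehand, so the symbols are compared
-- together with their declarations.
headSym-unique : {f : F σs τ} {σs′ : List (Ty B)} {g : F σs′ τ′} {s : Term F Γ σ} →
                 HeadSym f s → HeadSym g s → _≡_ {A = ∃₂ F} (σs , τ , f) (σs′ , τ′ , g)
headSym-unique (fun _) (fun _) = refl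
headSym-unique (app h) (app k) = headSym-unique h k

data HeadView {B : Set} {F : Signature B} {Γ : Ctx B} : {σ : Ty B} → Term F Γ σ → Set where
  bySym : {f : F σs τ} {t : Term F Γ σ} → HeadSym f t → HeadView t
  byVar : {x : Var Γ τ} {t : Term F Γ σ} → HeadVar x t → HeadView t
  abs   : (s : Term F (σ ∷ Γ) τ) → HeadView (lam s)
  redex : (u : Term F (σ ∷ Γ) τ) (v : Term F Γ σ) (ws : Spine F Γ τ ρ) →
          HeadView ((lam u · v) ·· ws)

headView : (t : Term F Γ σ) → HeadView t
headView (var x)    = byVar var
headView (lam s)    = abs s
headView (fun f ts) = bySym (fun ts)
headView (s · t) with headView s
... | bySym h       = bySym (app h)
... | byVar h       = byVar (app h)
... | abs u         = redex u t []
-- A spine lists the argument nearest to the head first, so the outermost argument `t` goes to its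
-- far end.
... | redex u v ws  = subst HeadView (··-snoc _ ws t) (redex u v (snoc ws t))

-- Contexts around the head of a spine

spineCxt : Cxt F Θ τ Γ σ → Spine F Γ σ ρ → Cxt F Θ τ Γ ρ
spineCxt C []       = C
spineCxt C (t ∷ ts) = spineCxt (appˡ C t) ts

plug-spineCxt : (C : Cxt F Θ τ Γ σ) (ts : Spine F Γ σ ρ) (u : Term F (Θ ʳ++ Γ) τ) →
                plug (spineCxt C ts) u ≡ plug C u ·· ts
plug-spineCxt C []       u = refl
plug-spineCxt C (t ∷ ts) u = plug-spineCxt (appˡ C t) ts u

compose     : Cxt F Θ σ Γ ρ → Cxt F [] τ (Θ ʳ++ Γ) σ → Cxt F Θ τ Γ ρ
composeArgs : CxtArgs F Θ σ Γ σs → Cxt F [] τ (Θ ʳ++ Γ) σ → CxtArgs F Θ τ Γ σs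
compose □          D = D
compose (appˡ C t) D = appˡ (compose C D) t
compose (appʳ s C) D = appʳ s (compose C D)
compose (lam C)    D = lam (compose C D)
compose (fun f C)  D = fun f (composeArgs C D)
composeArgs (here C ts) D = here (compose C D) ts
composeArgs (there t C) D = there t (composeArgs C D)

plug-compose     : (C : Cxt F Θ σ Γ ρ) (D : Cxt F [] τ (Θ ʳ++ Γ) σ) (u : Term F (Θ ʳ++ Γ) τ) →
                   plug (compose C D) u ≡ plug C (plug D u)
plugArgs-compose : (C : CxtArgs F Θ σ Γ σs) (D : Cxt F [] τ (Θ ʳ++ Γ) σ) (u : Term F (Θ ʳ++ Γ) τ) →
                   plugArgs (composeArgs C D) u ≡ plugArgs C (plug D u)
plug-compose □          D u = refl
plug-compose (appˡ C t) D u = cong (_· t) (plug-compose C D u)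
plug-compose (appʳ s C) D u = cong (s ·_) (plug-compose C D u)
plug-compose (lam C)    D u = cong lam (plug-compose C D u)
plug-compose (fun f C)  D u = cong (fun f) (plugArgs-compose C D u)
plugArgs-compose (here C ts) D u = cong (_∷ ts) (plug-compose C D u)
plugArgs-compose (there t C) D u = cong (t ∷_) (plugArgs-compose C D u)

-- `BetaFree` speaks of the bare redex; a redex with further arguments contains it at the head of
-- the spine, below the same binders `Θ`.
betaFree-headed : (C : Cxt F Θ ρ Γ τ) (u : Term F (σ ∷ (Θ ʳ++ Γ)) τ′) (v : Term F (Θ ʳ++ Γ) σ)
                  (ws : Spine F (Θ ʳ++ Γ) τ′ ρ) → ¬ BetaFree (plug C ((lam u · v) ·· ws))
betaFree-headed {Θ = Θ} C u v ws βf =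
  βf Θ u v (compose C (spineCxt □ ws) ,
            sym (trans (plug-compose C _ _) (cong (plug C) (plug-spineCxt □ ws _))))

isVar-headSym : {x : Var Γ ρ} {f : F σs τ} {t : Term F Γ σ} → IsVar x t → ¬ HeadSym f t
isVar-headSym var ()

-- Minimal bad subterms

-- `I` is a datum carried below binders by `ext`, such as a substitution to be lifted. The module is
-- used twice: for closed instances of subterms of a right-hand side, and for instances of subterms
-- under a lifted substitution.
module Selection (em : ExcludedMiddle 0ℓ) {B : Set} {F : Signature B}
                 (I : Ctx B → Set) (ext : ∀ {Γ τ} → I Γ → I (τ ∷ Γ))
                 (Good : ∀ {Γ σ} → I Γ → Term F Γ σ → Set) where

  below : ∀ Θ → I Γ → I (Θ ʳ++ Γ)
  below []      i = i
  below (_ ∷ Θ) i = below Θ (ext i)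

  GoodArgs : I Γ → All (Term F Γ) σs → Set
  GoodArgs i []       = ⊤
  GoodArgs i (t ∷ ts) = Good i t × GoodArgs i ts

  ImmediatelyGood : I Γ → Term F Γ σ → Set
  ImmediatelyGood i (var x)    = ⊤
  ImmediatelyGood i (s · t)    = Good i s × Good i t
  ImmediatelyGood i (lam s)    = Good (ext i) s
  ImmediatelyGood i (fun f ts) = GoodArgs i ts

  record MinimalBad {Γ σ} (i : I Γ) (t : Term F Γ σ) : Set where
    constructor minimalBad
    field
      {binders} : Ctx B
      {type}    : Ty B
      cxt       : Cxt F binders type Γ σ
      sub       : Term F (binders ʳ++ Γ) type
      occurs    : t ≡ plug cxt sub
      bad       : ¬ Good (below binders i) sub
      minimal   : ImmediatelyGood (below binders i) sub

  record MinimalBadArg {Γ σs} (i : I Γ) (ts : All (Term F Γ) σs) : Set where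
    constructor minimalBadArg
    field
      {binders} : Ctx B
      {type}    : Ty B
      cxt       : CxtArgs F binders type Γ σs
      sub       : Term F (binders ʳ++ Γ) type
      occurs    : ts ≡ plugArgs cxt sub
      bad       : ¬ Good (below binders i) sub
      minimal   : ImmediatelyGood (below binders i) sub

  -- Descends into a bad immediate subterm, found by excluded middle, for as long as there is one.
  -- The recursion is structural and ends at a bad term whose immediate subterms are all good.
  select     : (i : I Γ) (t : Term F Γ σ) → ¬ Good i t → MinimalBad i t
  selectArgs : (i : I Γ) (ts : All (Term F Γ) σs) → GoodArgs i ts ⊎ MinimalBadArg i ts
  select i (var x) b = minimalBad □ (var x) refl b tt
  select i (s · t) b with em {Good i s}
  ... | no bs = let minimalBad C u eq bu m = select i s bs in
                minimalBad (appˡ C t) u (cong (_· t) eq) bu m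
  ... | yes gs with em {Good i t}
  ...   | no bt  = let minimalBad C u eq bu m = select i t bt in
                   minimalBad (appʳ s C) u (cong (s ·_) eq) bu m
  ...   | yes gt = minimalBad □ (s · t) refl b (gs , gt)
  select i (lam s) b with em {Good (ext i) s}
  ... | no bs  = let minimalBad C u eq bu m = select (ext i) s bs in
                 minimalBad (lam C) u (cong lam eq) bu m
  ... | yes gs = minimalBad □ (lam s) refl b gs
  select i (fun f ts) b with selectArgs i ts
  ... | inj₁ gs = minimalBad □ (fun f ts) refl b gs
  ... | inj₂ (minimalBadArg C u eq bu m) = minimalBad (fun f C) u (cong (fun f) eq) bu m
  selectArgs i [] = inj₁ tt
  selectArgs i (t ∷ ts) with em {Good i t}
  ... | no bt = let minimalBad C u eq bu m = select i t bt in
                inj₂ (minimalBadArg (here C ts) u (cong (_∷ ts) eq) bu m)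
  ... | yes gt with selectArgs i ts
  ...   | inj₁ gs = inj₁ (gt , gs)
  ...   | inj₂ (minimalBadArg C u eq bu m) =
            inj₂ (minimalBadArg (there t C) u (cong (t ∷_) eq) bu m)

-- Reduction over the marked signature

module Reduction (em : ExcludedMiddle 0ℓ) {B : Set} (𝒜 : AFS B) where
  open AFS 𝒜

  F♯ : Signature B
  F♯ = Sym♯ 𝒜

  R♯ : List (Rule F♯)
  R♯ = rules♯ 𝒜

  ⌜_⌝ : Term Sym Γ σ → Term F♯ Γ σ
  ⌜_⌝ = embed 𝒜

  ⌜_⌝s : All (Term Sym Γ) σs → All (Term F♯ Γ) σs
  ⌜_⌝s = embeds 𝒜

  dne : {A : Set} → ¬ ¬ A → A
  dne {A} nn with em {A}
  ... | yes a = a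
  ... | no na = ⊥-elim (nn na)

  -- The embedding into the marked signature

  embed-rename  : (t : Term Sym Γ σ) (r : Ren Γ Δ) → ⌜ rename r t ⌝ ≡ rename r ⌜ t ⌝
  embeds-rename : (ts : All (Term Sym Γ) σs) (r : Ren Γ Δ) → ⌜ renames r ts ⌝s ≡ renames r ⌜ ts ⌝s
  embed-rename (var x)    r = refl
  embed-rename (s · t)    r = cong₂ _·_ (embed-rename s r) (embed-rename t r)
  embed-rename (lam s)    r = cong lam (embed-rename s (liftRen r))
  embed-rename (fun f ts) r = cong (fun (orig f)) (embeds-rename ts r)
  embeds-rename []       r = refl
  embeds-rename (t ∷ ts) r = cong₂ _∷_ (embed-rename t r) (embeds-rename ts r)

  embed-subst  : (t : Term Sym Γ σ) (γ : Sub Sym Γ Δ) → ⌜ t ⟨ γ ⟩ ⌝ ≡ ⌜ t ⌝ ⟨ (λ x → ⌜ γ x ⌝) ⟩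
  embeds-subst : (ts : All (Term Sym Γ) σs) (γ : Sub Sym Γ Δ) →
                 ⌜ substs γ ts ⌝s ≡ substs (λ x → ⌜ γ x ⌝) ⌜ ts ⌝s
  embed-subst (var x)    γ = refl
  embed-subst (s · t)    γ = cong₂ _·_ (embed-subst s γ) (embed-subst t γ)
  embed-subst (lam s)    γ = cong lam (trans (embed-subst s (liftSub γ))
    (subst-cong ⌜ s ⌝ _ _ λ { zero → refl ; (suc x) → embed-rename (γ x) suc }))
  embed-subst (fun f ts) γ = cong (fun (orig f)) (embeds-subst ts γ)
  embeds-subst []       γ = refl
  embeds-subst (t ∷ ts) γ = cong₂ _∷_ (embed-subst t γ) (embeds-subst ts γ)

  embed-single : (s : Term Sym (τ ∷ Γ) σ) (t : Term Sym Γ τ) → ⌜ s [ t ] ⌝ ≡ ⌜ s ⌝ [ ⌜ t ⌝ ]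
  embed-single s t = trans (embed-subst s (single t))
    (subst-cong ⌜ s ⌝ _ _ λ { zero → refl ; (suc x) → refl })

  embed-FV⁺  : {x : Var Γ τ} {t : Term Sym Γ σ} → x ∈FV t → x ∈FV ⌜ t ⌝
  embed-FVs⁺ : {x : Var Γ τ} {ts : All (Term Sym Γ) σs} → x ∈FVs ts → x ∈FVs ⌜ ts ⌝s
  embed-FV⁺ var      = var
  embed-FV⁺ (appˡ p) = appˡ (embed-FV⁺ p)
  embed-FV⁺ (appʳ p) = appʳ (embed-FV⁺ p)
  embed-FV⁺ (lam p)  = lam (embed-FV⁺ p)
  embed-FV⁺ (fun p)  = fun (embed-FVs⁺ p)
  embed-FVs⁺ (here p)  = here (embed-FV⁺ p)
  embed-FVs⁺ (there p) = there (embed-FVs⁺ p)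

  embed-FV⁻  : {x : Var Γ τ} (t : Term Sym Γ σ) → x ∈FV ⌜ t ⌝ → x ∈FV t
  embed-FVs⁻ : {x : Var Γ τ} (ts : All (Term Sym Γ) σs) → x ∈FVs ⌜ ts ⌝s → x ∈FVs ts
  embed-FV⁻ (var x)    var      = var
  embed-FV⁻ (s · t)    (appˡ p) = appˡ (embed-FV⁻ s p)
  embed-FV⁻ (s · t)    (appʳ p) = appʳ (embed-FV⁻ t p)
  embed-FV⁻ (lam s)    (lam p)  = lam (embed-FV⁻ s p)
  embed-FV⁻ (fun f ts) (fun p)  = fun (embed-FVs⁻ ts p)
  embed-FVs⁻ (t ∷ ts) (here p)  = here (embed-FV⁻ t p)
  embed-FVs⁻ (t ∷ ts) (there p) = there (embed-FVs⁻ ts p)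

  embed-headSym : {f : Sym σs τ} {t : Term Sym Γ σ} → HeadSym f t → HeadSym (orig f) ⌜ t ⌝
  embed-headSym (fun ts) = fun ⌜ ts ⌝s
  embed-headSym (app h)  = app (embed-headSym h)

  lhs-headed : {l r : Term Sym [] σ} → rule l r ∈ rules →
               ∃₂ λ σs τ → Σ (Sym σs τ) λ f → HeadSym f l
  lhs-headed p = IsRule.headed (All.lookup valid p)

  infix 4 _⟶_ _⟶s_

  -- The one-step relation by congruence rules, with arbitrary substitutions:
  -- finiteness of the domain is no restriction on a single rule.
  data _⟶_ {Γ : Ctx B} : {σ : Ty B} → Term F♯ Γ σ → Term F♯ Γ σ → Set
  data _⟶s_ {Γ : Ctx B} : {σs : List (Ty B)} → All (Term F♯ Γ) σs → All (Term F♯ Γ) σs → Set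
  data _⟶_ {Γ} where
    -- Source and target are described by equations, so that a step can be analysed by cases on the
    -- shape of its source.
    root : {l r : Term Sym [] σ} {s t : Term F♯ Γ σ} → rule l r ∈ rules → (γ : Sub F♯ [] Γ) →
           s ≡ ⌜ l ⌝ ⟨ γ ⟩ → t ≡ ⌜ r ⌝ ⟨ γ ⟩ → s ⟶ t
    beta : {s : Term F♯ (σ ∷ Γ) τ} {t : Term F♯ Γ σ} {u : Term F♯ Γ τ} → u ≡ s [ t ] → lam s · t ⟶ u
    appˡ : {s s′ : Term F♯ Γ (σ ⇒ τ)} {t : Term F♯ Γ σ} → s ⟶ s′ → s · t ⟶ s′ · t
    appʳ : {s : Term F♯ Γ (σ ⇒ τ)} {t t′ : Term F♯ Γ σ} → t ⟶ t′ → s · t ⟶ s · t′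
    lam  : {s s′ : Term F♯ (σ ∷ Γ) τ} → s ⟶ s′ → lam s ⟶ lam s′
    fun  : {f : F♯ σs τ} {ts ts′ : All (Term F♯ Γ) σs} → ts ⟶s ts′ → fun f ts ⟶ fun f ts′
  data _⟶s_ {Γ} where
    here  : {t t′ : Term F♯ Γ σ} {ts : All (Term F♯ Γ) σs} → t ⟶ t′ → t ∷ ts ⟶s t′ ∷ ts
    there : {t : Term F♯ Γ σ} {ts ts′ : All (Term F♯ Γ) σs} → ts ⟶s ts′ → t ∷ ts ⟶s t ∷ ts′

  plug-⟶     : (C : Cxt F♯ Θ τ Γ σ) {u v : Term F♯ (Θ ʳ++ Γ) τ} → u ⟶ v → plug C u ⟶ plug C v
  plugArgs-⟶ : (C : CxtArgs F♯ Θ τ Γ σs) {u v : Term F♯ (Θ ʳ++ Γ) τ} → u ⟶ v →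
               plugArgs C u ⟶s plugArgs C v
  plug-⟶ □          st = st
  plug-⟶ (appˡ C t) st = appˡ (plug-⟶ C st)
  plug-⟶ (appʳ s C) st = appʳ (plug-⟶ C st)
  plug-⟶ (lam C)    st = lam (plug-⟶ C st)
  plug-⟶ (fun f C)  st = fun (plugArgs-⟶ C st)
  plugArgs-⟶ (here C ts) st = here (plug-⟶ C st)
  plugArgs-⟶ (there t C) st = there (plugArgs-⟶ C st)

  fromRedex : {s t : Term F♯ Γ σ} → Redex R♯ s t → s ⟶ t
  fromRedex (rule p γ) with ∈-map⁻ _ p
  ... | ℓ , q , refl = root q (Subst.app γ) refl refl
  fromRedex (beta s t) = beta refl

  fromStep : {s t : Term F♯ Γ σ} → Step R♯ s t → s ⟶ t
  fromStep (step C red) = plug-⟶ C (fromRedex red)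

  fromStepArgs : {ss ts : All (Term F♯ Γ) σs} → StepArgs R♯ ss ts → ss ⟶s ts
  fromStepArgs (here st)  = here (fromStep st)
  fromStepArgs (there st) = there (fromStepArgs st)

  embed-redex : {s t : Term Sym Γ σ} → Redex rules s t → ⌜ s ⌝ ⟶ ⌜ t ⌝
  embed-redex (rule {l = l} {r} p γ) =
    root p (λ x → ⌜ Subst.app γ x ⌝) (embed-subst l (Subst.app γ)) (embed-subst r (Subst.app γ))
  embed-redex (beta s t) = beta (embed-single s t)

  embed-plug-step     : (C : Cxt Sym Θ τ Γ σ) {u v : Term Sym (Θ ʳ++ Γ) τ} → Redex rules u v →
                        ⌜ plug C u ⌝ ⟶ ⌜ plug C v ⌝
  embed-plugArgs-step : (C : CxtArgs Sym Θ τ Γ σs) {u v : Term Sym (Θ ʳ++ Γ) τ} → Redex rules u v →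
                        ⌜ plugArgs C u ⌝s ⟶s ⌜ plugArgs C v ⌝s
  embed-plug-step □          red = embed-redex red
  embed-plug-step (appˡ C t) red = appˡ (embed-plug-step C red)
  embed-plug-step (appʳ s C) red = appʳ (embed-plug-step C red)
  embed-plug-step (lam C)    red = lam (embed-plug-step C red)
  embed-plug-step (fun f C)  red = fun (embed-plugArgs-step C red)
  embed-plugArgs-step (here C ts) red = here (embed-plug-step C red)
  embed-plugArgs-step (there t C) red = there (embed-plugArgs-step C red)

  embed-step : {s t : Term Sym Γ σ} → Step rules s t → ⌜ s ⌝ ⟶ ⌜ t ⌝
  embed-step (step C red) = embed-plug-step C red

  restrict-app : (γ : Sub F♯ [] Γ) (x : Var [] σ) {P : Set} → Dec P → Term F♯ Γ σ
  restrict-app     γ x (yes _) = γ x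
  restrict-app {Γ} γ x (no _)  = var (named Γ x)

  -- The identity outside the list `xs`. With `xs` containing the variables of both sides of a rule
  -- or pair, this makes an arbitrary substitution finite without changing the instance.
  restrict : Sub F♯ [] Γ → NamedVars B → Subst F♯ Γ
  restrict {Γ} γ xs = record
    { app    = λ {σ} x → restrict-app γ x (em {(σ , x) ∈ xs})
    ; dom    = xs
    ; finite = λ {σ} x x∉ → outside x x∉ (em {(σ , x) ∈ xs})
    }
    where
    outside : (x : Var [] σ) → (σ , x) ∉ xs → (d : Dec ((σ , x) ∈ xs)) →
              restrict-app γ x d ≡ var (named Γ x)
    outside x x∉ (yes p) = ⊥-elim (x∉ p)
    outside x x∉ (no _)  = refl

  restrict-∈ : (γ : Sub F♯ [] Γ) (xs : NamedVars B) (x : Var [] σ) → (σ , x) ∈ xs →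
               Subst.app (restrict γ xs) x ≡ γ x
  restrict-∈ {σ = σ} γ xs x p with em {(σ , x) ∈ xs}
  ... | yes _ = refl
  ... | no np = ⊥-elim (np p)

  subst-restrict : (t : Term F♯ [] σ) (γ : Sub F♯ [] Γ) (xs : NamedVars B) →
                   (∀ {y : ∃ (Var [])} → y ∈ fvs t → y ∈ xs) →
                   t ⟨ Subst.app (restrict γ xs) ⟩ ≡ t ⟨ γ ⟩
  subst-restrict t γ xs h =
    subst-coincide t (Subst.app (restrict γ xs)) γ (λ x p → restrict-∈ γ xs x (h (∈-fvs p)))

  toStep     : {s t : Term F♯ Γ σ} → s ⟶ t → Step R♯ s t
  toStepArgs : {ss ts : All (Term F♯ Γ) σs} → ss ⟶s ts → StepArgs R♯ ss ts
  toStep (root {l = l} {r} p γ refl refl) =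
    subst₂ (Step R♯) (subst-restrict ⌜ l ⌝ γ xs ∈-++⁺ˡ) (subst-restrict ⌜ r ⌝ γ xs (∈-++⁺ʳ (fvs ⌜ l ⌝)))
      (step □ (rule (∈-map⁺ _ p) (restrict γ xs)))
    where xs = fvs ⌜ l ⌝ ++ fvs ⌜ r ⌝
  toStep (beta refl) = step □ (beta _ _)
  toStep (appˡ {t = t} st) with toStep st
  ... | step C red = step (appˡ C t) red
  toStep (appʳ {s = s} st) with toStep st
  ... | step C red = step (appʳ s C) red
  toStep (lam st) with toStep st
  ... | step C red = step (lam C) red
  toStep (fun {f = f} st) = inFun (toStepArgs st)
    where
    argCxt : {ss ts : All (Term F♯ _) σs} → StepArgs R♯ ss ts →
             Σ (Ctx B) λ Θ → Σ (Ty B) λ τ → Σ (CxtArgs F♯ Θ τ _ σs) λ C → ∃₂ λ u v →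
             Redex R♯ u v × ss ≡ plugArgs C u × ts ≡ plugArgs C v
    argCxt (here (step C red)) = _ , _ , here C _ , _ , _ , red , refl , refl
    argCxt (there st) with argCxt st
    ... | _ , _ , C , _ , _ , red , refl , refl = _ , _ , there _ C , _ , _ , red , refl , refl
    inFun : {ss ts : All (Term F♯ _) _} → StepArgs R♯ ss ts → Step R♯ (fun f ss) (fun f ts)
    inFun st with argCxt st
    ... | _ , _ , C , _ , _ , red , refl , refl = step (fun f C) red
  toStepArgs (here st)  = here (toStep st)
  toStepArgs (there st) = there (toStepArgs st)

  subst-⟶  : {s t : Term F♯ Γ σ} (δ : Sub F♯ Γ Δ) → s ⟶ t → s ⟨ δ ⟩ ⟶ t ⟨ δ ⟩
  substs-⟶ : {ss ts : All (Term F♯ Γ) σs} (δ : Sub F♯ Γ Δ) → ss ⟶s ts → substs δ ss ⟶s substs δ ts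
  subst-⟶ δ (root {l = l} {r} p γ refl refl) =
    root p (λ x → γ x ⟨ δ ⟩) (subst-subst ⌜ l ⌝ γ δ) (subst-subst ⌜ r ⌝ γ δ)
  subst-⟶ δ (beta {s = s} {t} refl) = beta (subst-single s t δ)
  subst-⟶ δ (appˡ st) = appˡ (subst-⟶ δ st)
  subst-⟶ δ (appʳ st) = appʳ (subst-⟶ δ st)
  subst-⟶ δ (lam st)  = lam (subst-⟶ (liftSub δ) st)
  subst-⟶ δ (fun st)  = fun (substs-⟶ δ st)
  substs-⟶ δ (here st)  = here (subst-⟶ δ st)
  substs-⟶ δ (there st) = there (substs-⟶ δ st)

  rename-⟶ : {s t : Term F♯ Γ σ} (r : Ren Γ Δ) → s ⟶ t → rename r s ⟶ rename r t
  rename-⟶ {s = s} {t} r st =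
    subst₂ _⟶_ (sym (rename-as-subst s r)) (sym (rename-as-subst t r)) (subst-⟶ _ st)

  infix 4 _⟶*_

  _⟶*_ : Term F♯ Γ σ → Term F♯ Γ σ → Set
  _⟶*_ = Star _⟶_

  -- A variable may occur any number of times in `t`, so one step in its value can become several
  -- steps or none.
  subst-⟶*  : (t : Term F♯ Γ σ) (γ δ : Sub F♯ Γ Δ) →
              (∀ {τ} (x : Var Γ τ) → γ x ⟶* δ x) → t ⟨ γ ⟩ ⟶* t ⟨ δ ⟩
  substs-⟶* : (ts : All (Term F♯ Γ) σs) (γ δ : Sub F♯ Γ Δ) →
              (∀ {τ} (x : Var Γ τ) → γ x ⟶* δ x) → Star _⟶s_ (substs γ ts) (substs δ ts)
  subst-⟶* (var x)    γ δ h = h x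
  subst-⟶* (s · t)    γ δ h = gmap (_· _) appˡ (subst-⟶* s γ δ h) ◅◅ gmap (_ ·_) appʳ (subst-⟶* t γ δ h)
  subst-⟶* (lam s)    γ δ h = gmap lam lam (subst-⟶* s (liftSub γ) (liftSub δ) λ
    { zero → ε ; (suc x) → gmap (rename suc) (rename-⟶ suc) (h x) })
  subst-⟶* (fun f ts) γ δ h = gmap (fun f) fun (substs-⟶* ts γ δ h)
  substs-⟶* []       γ δ h = ε
  substs-⟶* (t ∷ ts) γ δ h = gmap (_∷ _) here (subst-⟶* t γ δ h) ◅◅ gmap (_ ∷_) there (substs-⟶* ts γ δ h)

  single-⟶* : (s : Term F♯ (τ ∷ Γ) σ) {t t′ : Term F♯ Γ τ} → t ⟶ t′ → s [ t ] ⟶* s [ t′ ]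
  single-⟶* s st = subst-⟶* s _ _ λ { zero → st ◅ ε ; (suc x) → ε }

  ··-⟶ : {s s′ : Term F♯ Γ σ} (ws : Spine F♯ Γ σ τ) → s ⟶ s′ → s ·· ws ⟶ s′ ·· ws
  ··-⟶ []       st = st
  ··-⟶ (w ∷ ws) st = ··-⟶ ws (appˡ st)

  -- Strong normalisation

  _⟵_ : Term F♯ Γ σ → Term F♯ Γ σ → Set
  _⟵_ = flip _⟶_

  _⟵s_ : All (Term F♯ Γ) σs → All (Term F♯ Γ) σs → Set
  _⟵s_ = flip _⟶s_

  SN : Term F♯ Γ σ → Set
  SN = Acc _⟵_

  SNs : All (Term F♯ Γ) σs → Set
  SNs = Acc _⟵s_

  -- Descending sequences map forward along `f`. Taking `f` to be a term constructor or a
  -- substitution gives the passage of termination from a term to its subterms, and from an instance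
  -- back to the term.
  acc-reflect : {X Y : Set} {_<_ : X → X → Set} {_≺_ : Y → Y → Set} (f : X → Y) →
                (∀ {x y} → x < y → f x ≺ f y) → ∀ {x} → Acc _≺_ (f x) → Acc _<_ x
  acc-reflect f mono (acc h) = acc λ lt → acc-reflect f mono (h (mono lt))

  sn-⟶* : {s t : Term F♯ Γ σ} → s ⟶* t → SN s → SN t
  sn-⟶* ε         a       = a
  sn-⟶* (st ◅ ss) (acc h) = sn-⟶* ss (h st)

  sn-step : {s t : Term F♯ Γ σ} → s ⟶ t → SN s → SN t
  sn-step st (acc h) = h st

  sn-appˡ : {s : Term F♯ Γ (σ ⇒ τ)} {t : Term F♯ Γ σ} → SN (s · t) → SN s
  sn-appˡ {t = t} = acc-reflect (_· t) appˡ

  sn-appʳ : {s : Term F♯ Γ (σ ⇒ τ)} {t : Term F♯ Γ σ} → SN (s · t) → SN t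
  sn-appʳ {s = s} = acc-reflect (s ·_) appʳ

  sn-lam⁻ : {s : Term F♯ (σ ∷ Γ) τ} → SN (lam s) → SN s
  sn-lam⁻ = acc-reflect lam lam

  sn-fun⁻ : {f : F♯ σs τ} {ts : All (Term F♯ Γ) σs} → SN (fun f ts) → SNs ts
  sn-fun⁻ {f = f} = acc-reflect (fun f) fun

  sns-head : {t : Term F♯ Γ σ} {ts : All (Term F♯ Γ) σs} → SNs (t ∷ ts) → SN t
  sns-head {ts = ts} = acc-reflect (_∷ ts) here

  sns-tail : {t : Term F♯ Γ σ} {ts : All (Term F♯ Γ) σs} → SNs (t ∷ ts) → SNs ts
  sns-tail {t = t} = acc-reflect (t ∷_) there

  sns-[] : SNs {Γ = Γ} []
  sns-[] = acc λ ()

  sns-∷ : {t : Term F♯ Γ σ} {ts : All (Term F♯ Γ) σs} → SN t → SNs ts → SNs (t ∷ ts)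
  sns-∷ a@(acc h) b@(acc k) = acc λ
    { (here st)  → sns-∷ (h st) b
    ; (there st) → sns-∷ a (k st) }

  sn-subst⁻ : (t : Term F♯ Γ σ) (δ : Sub F♯ Γ Δ) → SN (t ⟨ δ ⟩) → SN t
  sn-subst⁻ t δ = acc-reflect (_⟨ δ ⟩) (subst-⟶ δ)

  sn-rename⁻ : (t : Term F♯ Γ σ) (r : Ren Γ Δ) → SN (rename r t) → SN t
  sn-rename⁻ t r = acc-reflect (rename r) (rename-⟶ r)

  c : ∀ σ → Term F♯ Γ σ
  c σ = fun (const σ) []

  -- Substituting a constant for the added variable undoes the weakening, and substitution instances
  -- reflect termination.
  sn-weaken : (t : Term F♯ Γ σ) → SN t → SN (rename {Δ = τ ∷ Γ} suc t)
  sn-weaken {τ = τ} t a =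
    sn-subst⁻ (rename suc t) (single (c τ)) (subst SN (sym (rename-suc-single t (c τ))) a)

  -- The rules of `R♯` are embedded rules of the original signature, so marked symbols and constants
  -- head no left-hand side.
  Defined♯ : F♯ σs τ → Set
  Defined♯ (orig f)   = Defined 𝒜 f
  Defined♯ (mark _ _) = ⊥
  Defined♯ (const _)  = ⊥

  root-headed : {l r : Term Sym [] σ} {s : Term F♯ Γ σ} → rule l r ∈ rules → (γ : Sub F♯ [] Γ) →
                s ≡ ⌜ l ⌝ ⟨ γ ⟩ → ∃₂ λ σs τ → Σ (F♯ σs τ) λ f → Defined♯ f × HeadSym f s
  root-headed p γ refl with lhs-headed p
  ... | _ , _ , f , h = _ , _ , orig f , lose p h , headSym-subst γ (embed-headSym h)

  sn-var : (x : Var Γ σ) → SN (var x)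
  sn-var x = acc λ { (root p γ eq _) → ⊥-elim (noHead (root-headed p γ eq)) }
    where
    noHead : ¬ ∃₂ λ σs τ → Σ (F♯ σs τ) λ f → Defined♯ f × HeadSym f (var x)
    noHead (_ , _ , _ , _ , ())

  sn-lam : {s : Term F♯ (σ ∷ Γ) τ} → SN s → SN (lam s)
  sn-lam {s = s} (acc h) = acc λ
    { (root p γ eq _) → ⊥-elim (noHead (root-headed p γ eq))
    ; (lam st)        → sn-lam (h st) }
    where
    noHead : ¬ ∃₂ λ σs τ → Σ (F♯ σs τ) λ f → Defined♯ f × HeadSym f (lam s)
    noHead (_ , _ , _ , _ , ())

  headVar-sym : {x : Var Γ ρ} {f : F♯ σs τ} {s : Term F♯ Γ σ} → HeadVar x s → ¬ HeadSym f s
  headVar-sym (app h) (app k) = headVar-sym h k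

  headVar-⟶ : {x : Var Γ ρ} {s t : Term F♯ Γ σ} → HeadVar x s → s ⟶ t → HeadVar x t
  headVar-⟶ h (root p γ eq _) with root-headed p γ eq
  ... | _ , _ , _ , _ , k = ⊥-elim (headVar-sym h k)
  headVar-⟶ (app ())  (beta _)
  headVar-⟶ (app h)   (appˡ st) = app (headVar-⟶ h st)
  headVar-⟶ (app h)   (appʳ _)  = app h

  -- A head variable survives every step and excludes contraction at the root, so all steps lie in
  -- `s` or in `t`; induction on both.
  sn-headVar : {x : Var Γ ρ} {s : Term F♯ Γ (σ ⇒ τ)} {t : Term F♯ Γ σ} →
               HeadVar x s → SN s → SN t → SN (s · t)
  sn-headVar {s = s} {t} h a@(acc k) b@(acc m) = acc (step-to h)
    where
    step-to : HeadVar _ s → ∀ {u} → s · t ⟶ u → SN u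
    step-to h (root p γ eq _) with root-headed p γ eq
    ... | _ , _ , _ , _ , app j = ⊥-elim (headVar-sym h j)
    step-to h (appˡ st) = sn-headVar (headVar-⟶ h st) (k st) b
    step-to h (appʳ st) = sn-headVar h a (m st)

  -- Minimal non-terminating terms

  ImmSN : Term F♯ Γ σ → Set
  ImmSN (var x)    = ⊤
  ImmSN (s · t)    = SN s × SN t
  ImmSN (lam s)    = SN s
  ImmSN (fun f ts) = SNs ts

  sn-imm : (t : Term F♯ Γ σ) → SN t → ImmSN t
  sn-imm (var x)    a = tt
  sn-imm (s · t)    a = sn-appˡ a , sn-appʳ a
  sn-imm (lam s)    a = sn-lam⁻ a
  sn-imm (fun f ts) a = sn-fun⁻ a

  MNT : Term F♯ Γ σ → Set
  MNT t = ¬ SN t × ImmSN t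

  imm-plug-subst : (C : Cxt F♯ Θ τ Γ σ) (u : Term F♯ (Θ ʳ++ Γ) τ) (γ : Sub F♯ Γ Δ) → ¬ IsHole C →
                   ImmSN (plug C u ⟨ γ ⟩) → SN (u ⟨ liftBelow Θ γ ⟩)
  sn-plug-subst  : (C : Cxt F♯ Θ τ Γ σ) (u : Term F♯ (Θ ʳ++ Γ) τ) (γ : Sub F♯ Γ Δ) →
                   SN (plug C u ⟨ γ ⟩) → SN (u ⟨ liftBelow Θ γ ⟩)
  sns-plug-subst : (C : CxtArgs F♯ Θ τ Γ σs) (u : Term F♯ (Θ ʳ++ Γ) τ) (γ : Sub F♯ Γ Δ) →
                   SNs (substs γ (plugArgs C u)) → SN (u ⟨ liftBelow Θ γ ⟩)
  imm-plug-subst □          u γ ¬□ _       = ⊥-elim (¬□ □)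
  imm-plug-subst (appˡ C t) u γ _  (a , _) = sn-plug-subst C u γ a
  imm-plug-subst (appʳ s C) u γ _  (_ , a) = sn-plug-subst C u γ a
  imm-plug-subst (lam C)    u γ _  a       = sn-plug-subst C u (liftSub γ) a
  imm-plug-subst (fun f C)  u γ _  a       = sns-plug-subst C u γ a
  sn-plug-subst □          u γ a = a
  sn-plug-subst (appˡ C t) u γ a = sn-plug-subst C u γ (sn-appˡ a)
  sn-plug-subst (appʳ s C) u γ a = sn-plug-subst C u γ (sn-appʳ a)
  sn-plug-subst (lam C)    u γ a = sn-plug-subst C u (liftSub γ) (sn-lam⁻ a)
  sn-plug-subst (fun f C)  u γ a = sns-plug-subst C u γ (sn-fun⁻ a)
  sns-plug-subst (here C ts) u γ a = sn-plug-subst C u γ (sns-head a)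
  sns-plug-subst (there t C) u γ a = sns-plug-subst C u γ (sns-tail a)

  sn-plug : (C : Cxt F♯ Θ τ Γ σ) (u : Term F♯ (Θ ʳ++ Γ) τ) → SN (plug C u) → SN u
  sn-plug {Θ = Θ} C u a =
    -- The general lemma at the identity substitution yields an instance of `u`, from which
    -- termination is reflected to `u` itself.
    sn-subst⁻ u (liftBelow Θ var) (sn-plug-subst C u var (subst SN (sym (subst-id (plug C u))) a))

  -- A strict subterm lies within an immediate one, and termination passes to subterms; so `ImmSN`
  -- yields the minimality condition on chains.
  imm-▷ : {t : Term F♯ Γ σ} (Θ : Ctx B) {u : Term F♯ (Θ ʳ++ Γ) τ} → ImmSN t → t ▷[ Θ ] u → SN u
  imm-▷ {t = t} Θ {u} a (C , ¬□ , refl) =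
    sn-subst⁻ u (liftBelow Θ var)
      (imm-plug-subst C u var ¬□ (subst ImmSN (sym (subst-id (plug C u))) a))

  -- The value `γ x` occurs in the instance, weakened below the binders passed on the way; each
  -- weakening is removed by reflection.
  sn-FV  : {x : Var Γ τ} (t : Term F♯ Γ σ) (γ : Sub F♯ Γ Δ) → x ∈FV t → SN (t ⟨ γ ⟩) → SN (γ x)
  sns-FV : {x : Var Γ τ} (ts : All (Term F♯ Γ) σs) (γ : Sub F♯ Γ Δ) → x ∈FVs ts →
           SNs (substs γ ts) → SN (γ x)
  sn-FV (var x)    γ var      a = a
  sn-FV (s · t)    γ (appˡ p) a = sn-FV s γ p (sn-appˡ a)
  sn-FV (s · t)    γ (appʳ p) a = sn-FV t γ p (sn-appʳ a)
  sn-FV (lam s)    γ (lam p)  a = sn-rename⁻ (γ _) suc (sn-FV s (liftSub γ) p (sn-lam⁻ a))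
  sn-FV (fun f ts) γ (fun p)  a = sns-FV ts γ p (sn-fun⁻ a)
  sns-FV (t ∷ ts) γ (here p)  a = sn-FV t γ p (sns-head a)
  sns-FV (t ∷ ts) γ (there p) a = sns-FV ts γ p (sns-tail a)

  -- A term headed by a function symbol is not a variable, so `x` occurs inside an immediate
  -- subterm.
  imm-FV : {x : Var Γ τ} {f : F♯ σs ρ} {t : Term F♯ Γ σ} (γ : Sub F♯ Γ Δ) → HeadSym f t → x ∈FV t →
           ImmSN (t ⟨ γ ⟩) → SN (γ x)
  imm-FV γ (fun ts)        (fun p)  a       = sns-FV ts γ p a
  imm-FV γ (app {s = s} _) (appˡ p) (a , _) = sn-FV s γ p a
  imm-FV γ (app {t = t} _) (appʳ p) (_ , a) = sn-FV t γ p a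

  sn-liftBelow : ∀ Θ (γ : Sub F♯ Γ Δ) → (∀ {τ} (x : Var Γ τ) → SN (γ x)) →
                 (x : Var (Θ ʳ++ Γ) σ) → SN (liftBelow Θ γ x)
  sn-liftBelow []      γ h = h
  sn-liftBelow (τ ∷ Θ) γ h = sn-liftBelow Θ (liftSub γ) λ
    { zero    → sn-var zero
    ; (suc x) → sn-weaken (γ x) (h x) }

  -- Head reductions of minimal non-terminating terms

  -- Heads that block contraction once applied to an argument: neither beta nor a rule applies at
  -- the root of `s · w`.
  Inert : Term F♯ Γ σ → Set
  Inert s = ¬ IsLam s × (∀ {σs τ} {f : F♯ σs τ} → ¬ HeadSym f s)

  -- A step among the arguments is returned for every head `u`, so that it can be repeated after the
  -- head has been contracted.
  ··-⟶⁻ : {s : Term F♯ Γ σ} {t : Term F♯ Γ τ} (ws : Spine F♯ Γ σ τ) → Inert s → s ·· ws ⟶ t →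
          (∃ λ s′ → s ⟶ s′ × t ≡ s′ ·· ws) ⊎
          (∃ λ ws′ → t ≡ s ·· ws′ × (∀ u → u ·· ws ⟶ u ·· ws′))
  ··-⟶⁻ [] _ st = inj₁ (_ , st , refl)
  ··-⟶⁻ (w ∷ ws) (¬l , ¬h) st with ··-⟶⁻ ws ((λ ()) , λ { (app h) → ¬h h }) st
  ... | inj₂ (ws′ , eq , cl)         = inj₂ (w ∷ ws′ , eq , λ u → cl (u · w))
  ... | inj₁ (_ , beta _ , _)        = ⊥-elim (¬l (lam _))
  ... | inj₁ (_ , appˡ st′ , eq)     = inj₁ (_ , st′ , eq)
  ... | inj₁ (_ , appʳ st′ , eq)     = inj₂ (_ ∷ ws , eq , λ u → ··-⟶ ws (appʳ st′))
  ... | inj₁ (_ , root p γ eq′ _ , _) with root-headed p γ eq′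
  ...   | _ , _ , _ , _ , app h      = ⊥-elim (¬h h)

  data RedexStep {Γ : Ctx B} (u : Term F♯ (σ ∷ Γ) τ) (v : Term F♯ Γ σ) (ws : Spine F♯ Γ τ ρ) :
                 Term F♯ Γ ρ → Set where
    contract : RedexStep u v ws (u [ v ] ·· ws)
    inBody   : {u′ : Term F♯ (σ ∷ Γ) τ} → u ⟶ u′ → RedexStep u v ws ((lam u′ · v) ·· ws)
    inArg    : {v′ : Term F♯ Γ σ} → v ⟶ v′ → RedexStep u v ws ((lam u · v′) ·· ws)
    inSpine  : (ws′ : Spine F♯ Γ τ ρ) → (∀ s → s ·· ws ⟶ s ·· ws′) →
               RedexStep u v ws ((lam u · v) ·· ws′)

  redex-⟶⁻ : (u : Term F♯ (σ ∷ Γ) τ) (v : Term F♯ Γ σ) (ws : Spine F♯ Γ τ ρ) {t : Term F♯ Γ ρ} →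
             (lam u · v) ·· ws ⟶ t → RedexStep u v ws t
  redex-⟶⁻ u v ws st with ··-⟶⁻ ws ((λ ()) , λ { (app ()) }) st
  ... | inj₂ (ws′ , refl , cl)           = inSpine ws′ cl
  ... | inj₁ (_ , beta refl , refl)      = contract
  ... | inj₁ (_ , appʳ st′ , refl)       = inArg st′
  ... | inj₁ (_ , appˡ (lam st′) , refl) = inBody st′
  ... | inj₁ (_ , root p γ eq _ , _) with root-headed p γ eq
  ...   | _ , _ , _ , _ , app ()
  redex-⟶⁻ u v ws st | inj₁ (_ , appˡ (root p γ eq _) , _) with root-headed p γ eq
  ...   | _ , _ , _ , _ , ()

  -- Each reduct is the contractum itself or again a redex whose contractum is reached from the old
  -- one. The induction is lexicographic on the termination of `u`, of `v`, and of the contractum;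
  -- the last decreases when the step is in the spine.
  sn-beta      : (u : Term F♯ (σ ∷ Γ) τ) (v : Term F♯ Γ σ) (ws : Spine F♯ Γ τ ρ) →
                 SN u → SN v → SN (u [ v ] ·· ws) → SN ((lam u · v) ·· ws)
  sn-redexStep : (u : Term F♯ (σ ∷ Γ) τ) (v : Term F♯ Γ σ) (ws : Spine F♯ Γ τ ρ) →
                 SN u → SN v → SN (u [ v ] ·· ws) → {t : Term F♯ Γ ρ} → RedexStep u v ws t → SN t
  sn-beta u v ws a b m = acc λ st → sn-redexStep u v ws a b m (redex-⟶⁻ u v ws st)
  sn-redexStep u v ws a b m contract =
    m
  sn-redexStep u v ws (acc h) b m (inBody st) =
    sn-beta _ v ws (h st) b (sn-step (··-⟶ ws (subst-⟶ (single v) st)) m)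
  sn-redexStep u v ws a (acc k) m (inArg st) =
    -- The argument may be copied or erased by the contraction, hence a reduction of any length.
    sn-beta u _ ws a (k st) (sn-⟶* (gmap (_·· ws) (··-⟶ ws) (single-⟶* u st)) m)
  sn-redexStep u v ws a b (acc j) (inSpine ws′ cl) =
    sn-beta u v ws′ a b (j (cl (u [ v ])))

  imm-··-head : (s : Term F♯ Γ (σ ⇒ τ)) (w : Term F♯ Γ σ) (ws : Spine F♯ Γ τ ρ) →
                ImmSN (s ·· (w ∷ ws)) → SN s
  imm-··-head s w []        (a , _) = a
  imm-··-head s w (w′ ∷ ws) a       = sn-appˡ (imm-··-head (s · w) w′ ws a)

  imm-··-arg : (s : Term F♯ Γ (σ ⇒ τ)) (w : Term F♯ Γ σ) (ws : Spine F♯ Γ τ ρ) →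
               ImmSN (s ·· (w ∷ ws)) → SN w
  imm-··-arg s w []        (_ , a) = a
  imm-··-arg s w (w′ ∷ ws) a       = sn-appʳ (imm-··-head (s · w) w′ ws a)

  -- With at least one argument present the head lies inside an immediate subterm, so reducing it
  -- keeps the immediate subterms terminating.
  imm-··-⟶ : {s s′ : Term F♯ Γ (σ ⇒ τ)} (w : Term F♯ Γ σ) (ws : Spine F♯ Γ τ ρ) → s ⟶ s′ →
             ImmSN (s ·· (w ∷ ws)) → ImmSN (s′ ·· (w ∷ ws))
  imm-··-⟶ w []        st (a , b) = sn-step st a , b
  imm-··-⟶ w (w′ ∷ ws) st a       = imm-··-⟶ w′ ws (appˡ st) a

  record HeadStep {Γ σ} (s t : Term F♯ Γ σ) : Set where
    constructor headStep
    field
      {type} : Ty B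
      {l r}  : Term Sym [] type
      ∈rules : rule l r ∈ rules
      γ      : Sub F♯ [] Γ
      args   : Spine F♯ Γ type σ
      source : s ≡ ⌜ l ⌝ ⟨ γ ⟩ ·· args
      target : t ≡ ⌜ r ⌝ ⟨ γ ⟩ ·· args

  headStep-app : {s s′ : Term F♯ Γ (σ ⇒ τ)} {t : Term F♯ Γ σ} → HeadStep s s′ → HeadStep (s · t) (s′ · t)
  headStep-app {t = t} (headStep p γ ws refl refl) =
    headStep p γ (snoc ws t) (sym (··-snoc _ ws t)) (sym (··-snoc _ ws t))

  headStep-defined : {f : F♯ σs τ} {s t : Term F♯ Γ σ} → HeadSym f s → HeadStep s t → Defined♯ f
  headStep-defined h (headStep p γ ws refl _) with root-headed p γ refl
  ... | _ , _ , g , d , k =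
    subst (λ (_ , _ , f) → Defined♯ f) (headSym-unique (headSym-·· ws k) h) d

  -- A function symbol at the head excludes a head beta step; a rule may still match a proper prefix
  -- of the spine, which `HeadStep` records with the remaining arguments.
  inner-or-head : {f : F♯ σs τ} {s t : Term F♯ Γ σ} → HeadSym f s → s ⟶ t → StepIn R♯ s t ⊎ HeadStep s t
  inner-or-head h         (root p γ eq eq′) = inj₂ (headStep p γ [] eq eq′)
  inner-or-head (fun ts)  (fun st)          = inj₁ (fun (toStepArgs st))
  inner-or-head (app ())  (beta _)
  inner-or-head (app h)   (appʳ st)         = inj₁ (appʳ h (toStep st))
  inner-or-head (app h)   (appˡ st) with inner-or-head h st
  ... | inj₁ i  = inj₁ (appˡ i)
  ... | inj₂ hd = inj₂ (headStep-app hd)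

  stepIn-⟶ : {s t : Term F♯ Γ σ} → StepIn R♯ s t → s ⟶ t
  stepIn-⟶ (fun st)    = fun (fromStepArgs st)
  stepIn-⟶ (appˡ st)   = appˡ (stepIn-⟶ st)
  stepIn-⟶ (appʳ _ st) = appʳ (fromStep st)

  stepIn-headSym : {f : F♯ σs τ} {s t : Term F♯ Γ σ} → StepIn R♯ s t → HeadSym f s → HeadSym f t
  stepIn-headSym (fun _)    (fun _) = fun _
  stepIn-headSym (appˡ st)  (app h) = app (stepIn-headSym st h)
  stepIn-headSym (appʳ _ _) (app h) = app h

  stepIn-imm : {s t : Term F♯ Γ σ} → StepIn R♯ s t → ImmSN s → ImmSN t
  stepIn-imm (fun st)    (acc h) = h (fromStepArgs st)
  stepIn-imm (appˡ st)   (a , b) = sn-step (stepIn-⟶ st) a , b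
  stepIn-imm (appʳ _ st) (a , b) = a , sn-step (fromStep st) b

  -- Inner steps leave the root intact and act on immediate subterms, which terminate even when `t`
  -- does not.
  stepIn-acc : (t : Term F♯ Γ σ) → ImmSN t → Acc (flip (StepIn R♯)) t
  stepIn-acc (var x)    _       = acc λ ()
  stepIn-acc (lam s)    _       = acc λ ()
  stepIn-acc (fun f ts) (acc h) = acc λ { (fun st) → stepIn-acc (fun f _) (h (fromStepArgs st)) }
  stepIn-acc (s · t)    (a , b) = app-acc (acc-reflect id stepIn-⟶ a) b
    where
    app-acc : ∀ {s t} → Acc (flip (StepIn R♯)) s → SN t → Acc (flip (StepIn R♯)) (s · t)
    app-acc a@(acc h) b@(acc k) = acc λ
      { (appˡ st)   → app-acc (h st) b
      ; (appʳ _ st) → app-acc a (k (fromStep st)) }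

  sn-successor : {s : Term F♯ Γ σ} → ¬ SN s → ∃ λ t → s ⟶ t × ¬ SN t
  sn-successor {s = s} ns with em {∃ λ t → s ⟶ t × ¬ SN t}
  ... | yes p = p
  ... | no np = ⊥-elim (ns (acc λ st → dne λ nt → np (_ , st , nt)))

  record Exposed {Γ σ} (s : Term F♯ Γ σ) : Set where
    constructor exposed
    field
      {s′ t} : Term F♯ Γ σ
      inner  : Star (StepIn R♯) s s′
      imm    : ImmSN s′
      head   : HeadStep s′ t
      bad    : ¬ SN t

  -- A non-terminating term has a non-terminating reduct. As long as no head step leads to one, an
  -- inner step does, and it preserves head symbol and minimality; inner steps are well-founded, so
  -- a head step must come.
  expose : {f : F♯ σs τ} {s : Term F♯ Γ σ} → HeadSym f s → MNT s → Exposed s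
  expose {s = s} h (ns , is) = go (stepIn-acc s is) h ns is
    where
    go : ∀ {s} → Acc (flip (StepIn R♯)) s → HeadSym _ s → ¬ SN s → ImmSN s → Exposed s
    go {s} (acc k) h ns is with em {∃ λ t → HeadStep s t × ¬ SN t}
    ... | yes (t , hd , nt) = exposed ε is hd nt
    ... | no np with sn-successor ns
    ...   | t , st , nt with inner-or-head h st
    ...     | inj₂ hd = ⊥-elim (np (t , hd , nt))
    ...     | inj₁ i with go (k i) (stepIn-headSym i h) nt (stepIn-imm i is)
    ...       | exposed ss is′ hd nt′ = exposed (i ◅ ss) is′ hd nt′

  -- The head symbol survives the inner steps up to the exposed head step, whose rule defines it. In
  -- particular no marked symbol or constant heads a minimal non-terminating term.
  expose-defined : {f : F♯ σs τ} {s : Term F♯ Γ σ} → HeadSym f s → MNT s → Defined♯ f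
  expose-defined h m with expose h m
  ... | exposed ss _ hd _ = headStep-defined (headSym-in ss h) hd
    where
    headSym-in : {f : F♯ σs τ} {s t : Term F♯ Γ σ} → Star (StepIn R♯) s t → HeadSym f s → HeadSym f t
    headSym-in ε         h = h
    headSym-in (st ◅ ss) h = headSym-in ss (stepIn-headSym st h)

  noDescent : {X : Set} {_<_ : X → X → Set} (f : ℕ → X) → Acc _<_ (f zero) → ¬ (∀ n → f (suc n) < f n)
  noDescent f (acc h) d = noDescent (f ∘ suc) (h (d zero)) (d ∘ suc)

  sn-terminating : {t : Term F♯ Γ σ} → SN t → TerminatingTerm R♯ t
  sn-terminating a (f , refl , d) = noDescent f a (fromStep ∘ d)

  -- Were all embedded terms accessible, embedding an infinite reduction would give an impossible
  -- descent; double negation elimination turns this into a witness.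
  nonterminating : ¬ TerminatingAFS 𝒜 → Σ (Ctx B) λ Γ → Σ (Ty B) λ σ → Σ (Term Sym Γ σ) λ t → ¬ SN ⌜ t ⌝
  nonterminating nt = dne λ none → nt λ t (f , f0 , d) →
    none (_ , _ , t , λ a → noDescent (⌜_⌝ ∘ f) (subst (SN ∘ ⌜_⌝) (sym f0) a) (embed-step ∘ d))

  -- Marking

  markFun : (f : Sym σs τ) → Dec (Defined 𝒜 f) → All (Term F♯ Γ) σs → Term F♯ Γ τ
  markFun f (yes d) ts = fun (mark f d) ts
  markFun f (no _)  ts = fun (orig f) ts

  infix 9 _♯

  -- The relation `Marked` as a function, with definedness decided by excluded middle.
  _♯ : Term F♯ Γ σ → Term F♯ Γ σ
  var x             ♯ = var x
  (s · t)           ♯ = s · t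
  lam s             ♯ = lam s
  fun (orig f) ts   ♯ = markFun f em ts
  fun (mark f d) ts ♯ = fun (mark f d) ts
  fun (const σ) ts  ♯ = fun (const σ) ts

  ♯-marked : (t : Term F♯ Γ σ) → Marked 𝒜 t (t ♯)
  ♯-marked (var x)             = unmarked λ ()
  ♯-marked (s · t)             = unmarked λ ()
  ♯-marked (lam s)             = unmarked λ ()
  ♯-marked (fun (mark f d) ts) = unmarked λ ()
  ♯-marked (fun (const σ) ts)  = unmarked λ ()
  ♯-marked (fun (orig f) ts) with em {Defined 𝒜 f}
  ... | yes d = marked d ts
  ... | no nd = unmarked λ { (markable d _) → nd d }

  -- A variable could be replaced by a term with a markable root; in all other cases the root symbol
  -- is already that of `t`.
  ♯-subst : (t : Term F♯ Γ σ) (γ : Sub F♯ Γ Δ) → (∀ {τ} (x : Var Γ τ) → ¬ IsVar x t) →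
            (t ⟨ γ ⟩) ♯ ≡ t ♯ ⟨ γ ⟩
  ♯-subst (var x)             γ ¬v = ⊥-elim (¬v x var)
  ♯-subst (s · t)             γ _  = refl
  ♯-subst (lam s)             γ _  = refl
  ♯-subst (fun (mark f d) ts) γ _  = refl
  ♯-subst (fun (const σ) ts)  γ _  = refl
  ♯-subst (fun (orig f) ts)   γ _ with em {Defined 𝒜 f}
  ... | yes _ = refl
  ... | no _  = refl

  ♯-·· : (s : Term F♯ Γ (σ ⇒ τ)) (w : Term F♯ Γ σ) (ws : Spine F♯ Γ τ ρ) →
         (s ·· (w ∷ ws)) ♯ ≡ s ·· (w ∷ ws)
  ♯-·· s w []        = refl
  ♯-·· s w (w′ ∷ ws) = ♯-·· (s · w) w′ ws

  imm-♯ : (t : Term F♯ Γ σ) → ImmSN t → ImmSN (t ♯)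
  imm-♯ (var x)             a = a
  imm-♯ (s · t)             a = a
  imm-♯ (lam s)             a = a
  imm-♯ (fun (mark f d) ts) a = a
  imm-♯ (fun (const σ) ts)  a = a
  imm-♯ (fun (orig f) ts)   a with em {Defined 𝒜 f}
  ... | yes _ = a
  ... | no _  = a

  stepIn-♯ : {s t : Term F♯ Γ σ} → StepIn R♯ s t → StepIn R♯ (s ♯) (t ♯)
  stepIn-♯ (appˡ st)                = appˡ st
  stepIn-♯ (appʳ h st)              = appʳ h st
  stepIn-♯ (fun {f = mark f d} st)  = fun st
  stepIn-♯ (fun {f = const σ} st)   = fun st
  stepIn-♯ (fun {f = orig f} st) with em {Defined 𝒜 f}
  ... | yes _ = fun st
  ... | no _  = fun st

  -- Links of the chain

  -- The target is kept unmarked, because its rules must remain applicable at the root for it to be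
  -- non-terminating; the chain itself contains `target ♯`.
  record Next {Γ σ} (s : Term F♯ Γ σ) : Set where
    constructor next
    field
      {ctx}  : Ctx B
      {type} : Ty B
      label  : Label 𝒜
      target : Term F♯ ctx type
      mnt    : MNT target
      link   : ChainStep 𝒜 label s (target ♯)

  next-pair : {l : Term F♯ [] σ} {p : Term F♯ [] τ} {s : Term F♯ Γ σ} (t : Term F♯ Γ τ) →
              DP 𝒜 l p → (γ : Sub F♯ [] Γ) → MNT t → s ≡ l ⟨ γ ⟩ → t ♯ ≡ p ⟨ γ ⟩ → Next s
  next-pair {l = l} {p} t d γ m refl eq = next (dp d) t m
    (subst₂ (λ s t → ChainStep 𝒜 (dp d) s t)
      (subst-restrict l γ xs ∈-++⁺ˡ)
      (trans (subst-restrict p γ xs (∈-++⁺ʳ (fvs l))) (sym eq))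
      (pair d (restrict γ xs)))
    where xs = fvs l ++ fvs p

  -- A constant has no arguments, so if it did not terminate it would be minimal and its symbol
  -- would be defined.
  sn-c : ∀ σ → SN {Γ = Γ} (c σ)
  sn-c σ = dne λ n → expose-defined (fun []) (n , sns-[])

  named-or-const : ∀ Γ (y : Var Γ σ) → (∃ λ x → y ≡ named Γ x) ⊎ (close 𝒜 y ≡ c σ)
  named-or-const []      y    = inj₁ (y , refl)
  named-or-const (τ ∷ Γ) zero = inj₂ refl
  named-or-const (τ ∷ Γ) (suc y) with named-or-const Γ y
  ... | inj₁ (x , eq) = inj₁ (x , cong suc eq)
  ... | inj₂ eq       = inj₂ eq

  headVar-const : {y : Var Γ τ} {t : Term Sym Γ σ} (γ : Sub F♯ [] Δ) → close 𝒜 y ≡ c τ → HeadVar y t →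
                  HeadSym (const τ) (⌜ t ⌝ ⟨ close 𝒜 ⟩ ⟨ γ ⟩)
  headVar-const γ eq var     = subst (λ s → HeadSym (const _) (s ⟨ γ ⟩)) (sym eq) (fun [])
  headVar-const γ eq (app h) = app (headVar-const γ eq h)

  module RootStep (γ : Sub F♯ [] Δ) (γ-SN : ∀ {σ} (x : Var [] σ) → SN (γ x)) where

    closed : Term Sym Γ σ → Term F♯ Δ σ
    closed t = ⌜ t ⌝ ⟨ close 𝒜 ⟩ ⟨ γ ⟩

    -- Badness is judged on the closed instance. Closing is determined by the context alone, so the
    -- carried datum is trivial.
    open Selection em {F = Sym} (λ _ → ⊤) (λ _ → tt) (λ _ t → SN (closed t))

    closed-var : (y : Var Γ σ) → SN (closed (var y))
    closed-var (free n) = γ-SN (free n)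
    closed-var zero     = sn-c _
    closed-var (suc y)  = closed-var y

    -- The closed body has a constant in place of the bound variable, while the body of the closed
    -- abstraction keeps it. The former is thus an instance of the latter, to which termination is
    -- reflected.
    closed-lam : (s : Term Sym (σ ∷ Γ) τ) →
                 ⌜ s ⌝ ⟨ liftSub (close 𝒜) ⟩ ⟨ liftSub γ ⟩ [ c σ ] ≡ closed s
    closed-lam s = trans (cong (_⟨ single (c _) ⟩) (subst-subst ⌜ s ⌝ _ _))
      (trans (subst-subst ⌜ s ⌝ _ _)
        (trans (subst-cong ⌜ s ⌝ _ _ λ
          { zero → refl
          ; (suc y) → trans (cong (_⟨ single (c _) ⟩) (lift-subst (close 𝒜) γ (suc y)))
                            (rename-suc-single (close 𝒜 y ⟨ γ ⟩) (c _)) })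
          (sym (subst-subst ⌜ s ⌝ _ _))))

    closed-imm  : (t : Term Sym Γ σ) → ImmediatelyGood tt t → ImmSN (closed t)
    closed-args : (ts : All (Term Sym Γ) σs) → GoodArgs tt ts → SNs (substs γ (substs (close 𝒜) ⌜ ts ⌝s))
    closed-imm (var y)    _       = sn-imm _ (closed-var y)
    closed-imm (s · t)    g       = g
    closed-imm (lam s)    a       = sn-subst⁻ _ (single (c _)) (subst SN (sym (closed-lam s)) a)
    closed-imm (fun f ts) g       = closed-args ts g
    closed-args []       _        = sns-[]
    closed-args (t ∷ ts) (g , gs) = sns-∷ g (closed-args ts gs)

    -- Minimality excludes abstractions and bare variables, beta-freeness of the right-hand side
    -- excludes redexes, and a bound head variable becomes an undefined constant. What is left are
    -- the two forms of candidate terms.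
    candidate : (C : Cxt Sym Θ τ [] ρ) (t : Term Sym (Θ ʳ++ []) τ) → BetaFree (plug C t) →
                MNT (closed t) → Candidate 𝒜 t
    candidate {Θ = Θ} C t βf m@(nt , it) with headView t
    ... | bySym h       = bySym (expose-defined (headSym-subst γ (headSym-subst (close 𝒜) (embed-headSym h))) m) h
    ... | abs s         = ⊥-elim (nt (sn-lam it))
    ... | redex u v ws  = ⊥-elim (betaFree-headed C u v ws βf)
    ... | byVar {x = y} h with named-or-const (Θ ʳ++ []) y
    ...   | inj₂ eq = ⊥-elim (expose-defined (headVar-const γ eq h) m)
    ...   | inj₁ (x , refl) with h
    ...     | var    = ⊥-elim (nt (closed-var (named (Θ ʳ++ []) x)))
    ...     | app h′ = byVar x h′

    next-root : {l r : Term Sym [] σ} → rule l r ∈ rules → ImmSN (⌜ l ⌝ ⟨ γ ⟩) → ¬ SN (⌜ r ⌝ ⟨ γ ⟩) →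
                Next ((⌜ l ⌝ ⟨ γ ⟩) ♯)
    next-root {l = l} {r} p il nr with select tt r (nr ∘ subst SN closed-r)
      where
      closed-r : closed r ≡ ⌜ r ⌝ ⟨ γ ⟩
      closed-r = cong (_⟨ γ ⟩) (trans (subst-cong ⌜ r ⌝ (close 𝒜) var λ { (free n) → refl }) (subst-id ⌜ r ⌝))
    ... | minimalBad {Θ} C t refl bad min =
      next-pair (closed t)
        (cand p (cand Θ t (C , refl) (candidate C t (IsRule.rhs-βf (All.lookup valid p)) m))
          not-in-l (♯-marked ⌜ l ⌝) (♯-marked t̂))
        γ m (♯-subst ⌜ l ⌝ γ l-not-var) (♯-subst t̂ γ λ x v → bad (sn-isVar v))
      where
      m : MNT (closed t)
      m = bad , closed-imm t min
      t̂ : Term F♯ [] _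
      t̂ = ⌜ t ⌝ ⟨ close 𝒜 ⟩
      not-in-l : ∀ Ξ → ¬ (⌜ l ⌝ ▷[ Ξ ] rename (wkBelow Ξ) t̂)
      -- An occurrence as a strict subterm of `l` would make the instance of the candidate
      -- terminate, by minimality of the instance of `l`.
      not-in-l Ξ (D , ¬□ , eq) = bad (sn-rename⁻ _ (wkBelow Ξ) (subst SN (subst-wkBelow Ξ γ t̂)
        (imm-plug-subst D _ γ ¬□ (subst (λ s → ImmSN (s ⟨ γ ⟩)) eq il))))
      l-not-var : ∀ {τ} (x : Var [] τ) → ¬ IsVar x ⌜ l ⌝
      l-not-var x v = isVar-headSym v (embed-headSym (proj₂ (proj₂ (proj₂ (lhs-headed p)))))
      sn-isVar : {x : Var [] τ} {s : Term F♯ [] σ} → IsVar x s → SN (s ⟨ γ ⟩)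
      sn-isVar {x = x} var = γ-SN x

  normalise-at : (γ : Sub F♯ [] Γ) (x : Var [] σ) → Dec (SN (γ x)) → Term F♯ Γ σ
  normalise-at     γ x (yes _) = γ x
  normalise-at {Γ} γ x (no _)  = var (named Γ x)

  -- Minimality controls `γ` only on the variables of the left-hand side, whereas `RootStep` asks
  -- for terminating values everywhere; other non-terminating values are reset to the variable
  -- itself.
  normalise : Sub F♯ [] Γ → Sub F♯ [] Γ
  normalise γ x = normalise-at γ x em

  normalise-SN : (γ : Sub F♯ [] Γ) (x : Var [] σ) → SN (normalise γ x)
  normalise-SN γ x with em {SN (γ x)}
  ... | yes a = a
  ... | no _  = sn-var _

  normalise-≡ : (γ : Sub F♯ [] Γ) (x : Var [] σ) → SN (γ x) → γ x ≡ normalise γ x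
  normalise-≡ γ x a with em {SN (γ x)}
  ... | yes _ = refl
  ... | no n  = ⊥-elim (n a)

  next-root : {l r : Term Sym [] σ} → rule l r ∈ rules → (γ : Sub F♯ [] Γ) →
              ImmSN (⌜ l ⌝ ⟨ γ ⟩) → ¬ SN (⌜ r ⌝ ⟨ γ ⟩) → Next ((⌜ l ⌝ ⟨ γ ⟩) ♯)
  next-root {l = l} {r} p γ il nr = subst (λ s → Next (s ♯)) (sym l-eq)
    (RootStep.next-root (normalise γ) (normalise-SN γ) p (subst ImmSN l-eq il) (nr ∘ subst SN (sym r-eq)))
    where
    γ-SN : ∀ {τ} (x : Var [] τ) → x ∈FV ⌜ l ⌝ → SN (γ x)
    γ-SN x q = imm-FV γ (embed-headSym (proj₂ (proj₂ (proj₂ (lhs-headed p))))) q il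
    l-eq : ⌜ l ⌝ ⟨ γ ⟩ ≡ ⌜ l ⌝ ⟨ normalise γ ⟩
    l-eq = subst-coincide ⌜ l ⌝ γ (normalise γ) λ x q → normalise-≡ γ x (γ-SN x q)
    r-eq : ⌜ r ⌝ ⟨ γ ⟩ ≡ ⌜ r ⌝ ⟨ normalise γ ⟩
    r-eq = subst-coincide ⌜ r ⌝ γ (normalise γ) λ x q →
      -- The variables of the right-hand side occur in the left-hand side, where their values
      -- terminate.
      normalise-≡ γ x (γ-SN x (embed-FV⁺ (IsRule.vars (All.lookup valid p) x (embed-FV⁻ r q))))

  -- Rules applied to further arguments

  update-at : (γ : Sub F♯ [] Γ) (y : Var [] σ) (w : Term F♯ Γ σ) (x : Var [] τ) →
              Dec (_≡_ {A = ∃ (Var [])} (σ , y) (τ , x)) → Term F♯ Γ τ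
  update-at γ y w x (yes refl) = w
  update-at γ y w x (no _)     = γ x

  update : Sub F♯ [] Γ → Var [] σ → Term F♯ Γ σ → Sub F♯ [] Γ
  update γ y w x = update-at γ y w x em

  update-same : (γ : Sub F♯ [] Γ) (y : Var [] σ) (w : Term F♯ Γ σ) → update γ y w y ≡ w
  update-same {σ = σ} γ y w with em {_≡_ {A = ∃ (Var [])} (σ , y) (σ , y)}
  ... | yes refl = refl
  ... | no n     = ⊥-elim (n refl)

  update-other : (γ : Sub F♯ [] Γ) (y : Var [] σ) (w : Term F♯ Γ σ) (x : Var [] τ) →
                 ¬ (_≡_ {A = ∃ (Var [])} (σ , y) (τ , x)) → update γ y w x ≡ γ x
  update-other {σ = σ} {τ = τ} γ y w x n with em {_≡_ {A = ∃ (Var [])} (σ , y) (τ , x)}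
  ... | yes p = ⊥-elim (n p)
  ... | no _  = refl

  ∉FV-≢ : {y : Var [] σ} (t : Term Sym [] ρ) → ¬ y ∈FV t → {x : Var [] τ} → x ∈FV t →
          ¬ (_≡_ {A = ∃ (Var [])} (σ , y) (τ , x))
  ∉FV-≢ t y∉ x∈ refl = y∉ x∈

  update-app : (t : Term Sym [] (σ ⇒ τ)) (γ : Sub F♯ [] Γ) (y : Var [] σ) (w : Term F♯ Γ σ) → ¬ y ∈FV t →
               ⌜ t · var y ⌝ ⟨ update γ y w ⟩ ≡ ⌜ t ⌝ ⟨ γ ⟩ · w
  update-app t γ y w y∉ = cong₂ _·_
    (subst-coincide ⌜ t ⌝ (update γ y w) γ λ x q → update-other γ y w x (∉FV-≢ t y∉ (embed-FV⁻ t q)))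
    (update-same γ y w)

  -- The right-hand side of the rule added by completion is instantiated to the contractum of the
  -- instance of `lam r` applied to `w`.
  update-beta : (r : Term Sym (σ ∷ []) τ) (γ : Sub F♯ [] Γ) (y : Var [] σ) (w : Term F♯ Γ σ) →
                ¬ y ∈FV lam r → ⌜ r [ var y ] ⌝ ⟨ update γ y w ⟩ ≡ (⌜ r ⌝ ⟨ liftSub γ ⟩) [ w ]
  update-beta r γ y w y∉ = trans (cong (_⟨ update γ y w ⟩) (embed-single r (var y)))
    (trans (subst-subst ⌜ r ⌝ _ _)
      (trans (subst-coincide ⌜ r ⌝ _ _ λ
        { zero    _ → update-same γ y w
        ; (suc x) q → trans (update-other γ y w x (∉FV-≢ (lam r) y∉ (lam (embed-FV⁻ r q))))
                            (sym (rename-suc-single (γ x) w)) })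
        (sym (subst-subst ⌜ r ⌝ (liftSub γ) (single w)))))

  record Extension {ρ τ Γ} (l r : Term Sym [] ρ) (s t : Term F♯ Γ τ) : Set where
    constructor extension
    field
      {l′ r′} : Term Sym [] τ
      ext     : Extend 𝒜 l r l′ r′
      γ       : Sub F♯ [] Γ
      source  : s ≡ ⌜ l′ ⌝ ⟨ γ ⟩
      target  : t ≡ ⌜ r′ ⌝ ⟨ γ ⟩

  -- Each further argument becomes the value of a fresh variable, which leaves the instances built
  -- so far unchanged.
  extend-spine : {l r : Term Sym [] ρ} {l′ r′ : Term Sym [] σ} → Extend 𝒜 l r l′ r′ → (γ : Sub F♯ [] Γ) →
                 (ws : Spine F♯ Γ σ τ) → Extension l r (⌜ l′ ⌝ ⟨ γ ⟩ ·· ws) (⌜ r′ ⌝ ⟨ γ ⟩ ·· ws)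
  extend-spine e γ [] = extension e γ refl refl
  extend-spine {l = l} {r} {l′} {r′} e γ (_∷_ {σ = σ} w ws) with fresh-var σ l′ r′
  ... | y , y∉l , y∉r =
    subst₂ (λ s t → Extension l r (s ·· ws) (t ·· ws)) (update-app l′ γ y w y∉l) (update-app r′ γ y w y∉r)
      (extend-spine (more e y y∉l y∉r) (update γ y w) ws)

  extend-app : (l r : Term Sym [] (σ ⇒ τ)) (γ : Sub F♯ [] Γ) (w : Term F♯ Γ σ) (ws : Spine F♯ Γ τ ρ) →
               Extension l r (⌜ l ⌝ ⟨ γ ⟩ ·· (w ∷ ws)) (⌜ r ⌝ ⟨ γ ⟩ ·· (w ∷ ws))
  extend-app {σ = σ} l r γ w ws with fresh-var σ l r
  ... | y , y∉l , y∉r =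
    subst₂ (λ s t → Extension l r (s ·· ws) (t ·· ws)) (update-app l γ y w y∉l) (update-app r γ y w y∉r)
      (extend-spine (one y y∉l y∉r) (update γ y w) ws)

  rhs-head : {l r : Term Sym [] σ} → rule l r ∈ rules → ¬ IsLam r → (γ : Sub F♯ [] Γ) (ws : Spine F♯ Γ σ τ) →
             MNT (⌜ r ⌝ ⟨ γ ⟩ ·· ws) → DefinedOrVarHead 𝒜 r
  rhs-head {r = r} p ¬lam γ ws m with IsRule.rhs-βf (All.lookup valid p)
  ... | βf with headView r
  ...   | bySym h       = bySym (expose-defined (headSym-·· ws (headSym-subst γ (embed-headSym h))) m) h
  ...   | byVar h       = byVar _ h
  ...   | abs s         = ⊥-elim (¬lam (lam s))
  ...   | redex u v vs  = ⊥-elim (betaFree-headed □ u v vs βf)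

  -- Without arguments a candidate pair applies; with arguments and `r` not an abstraction, an
  -- extension pair. Otherwise completion supplies a rule for `l · var x` that absorbs the first
  -- argument, and the recursion follows the completion.
  next-rule : {l r : Term Sym [] σ} → rule l r ∈ rules → Completes rules l r →
              (γ : Sub F♯ [] Γ) (ws : Spine F♯ Γ σ τ) →
              ImmSN (⌜ l ⌝ ⟨ γ ⟩ ·· ws) → ¬ SN (⌜ r ⌝ ⟨ γ ⟩ ·· ws) → Next ((⌜ l ⌝ ⟨ γ ⟩ ·· ws) ♯)
  next-rule p _ γ [] il nr = next-root p γ il nr
  next-rule {l = l} {r} p (done ¬lam) γ (w ∷ ws) il nr with extend-app l r γ w ws
  ... | extension e δ eq eq′ = subst Next (sym (♯-·· _ w ws))
    (next-pair _ (extend p (rhs-head p ¬lam γ (w ∷ ws) m) e) δ m eq (trans (♯-·· _ w ws) eq′))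
    where
    m : MNT (⌜ r ⌝ ⟨ γ ⟩ ·· (w ∷ ws))
    m = nr , imm-··-⟶ w ws (root p γ refl refl) il
  next-rule p (next {l = l} {r} x x∉l x∉r q cs) γ (w ∷ ws) il nr =
    subst (λ s → Next ((s ·· ws) ♯)) l-eq
      (next-rule q cs (update γ x w) ws
        (subst (λ s → ImmSN (s ·· ws)) (sym l-eq) il)
        -- If the contractum terminated, so would the beta-redex; the required termination of body
        -- and argument comes from the minimality of the reduct, `ir`.
        (nr ∘ sn-beta _ w ws (sn-lam⁻ (imm-··-head _ w ws ir)) (imm-··-arg _ w ws ir)
            ∘ subst (λ s → SN (s ·· ws)) (update-beta r γ x w x∉r)))
    where
    l-eq : ⌜ l · var x ⌝ ⟨ update γ x w ⟩ ≡ ⌜ l ⌝ ⟨ γ ⟩ · w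
    l-eq = update-app l γ x w x∉l
    ir : ImmSN (⌜ lam r ⌝ ⟨ γ ⟩ ·· (w ∷ ws))
    ir = imm-··-⟶ w ws (root p γ refl refl) il

  -- Links from beta-redexes

  record SubFrom (Γ : Ctx B) : Set where
    constructor subFrom
    field
      {codomain} : Ctx B
      sub        : Sub F♯ Γ codomain

  liftFrom : SubFrom Γ → SubFrom (τ ∷ Γ)
  liftFrom (subFrom γ) = subFrom (liftSub γ)

  -- The carried datum may depend on the current context only, so `SubFrom` hides the codomain,
  -- which grows with each binder.
  open Selection em {F = F♯} SubFrom liftFrom (λ γ t → SN (t ⟨ SubFrom.sub γ ⟩))

  below-lift : ∀ Θ (γ : Sub F♯ Γ Δ) → below Θ (subFrom γ) ≡ subFrom (liftBelow Θ γ)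
  below-lift []      γ = refl
  below-lift (_ ∷ Θ) γ = below-lift Θ (liftSub γ)

  imm-subst  : (t : Term F♯ Γ σ) (γ : Sub F♯ Γ Δ) → (∀ {τ} (x : Var Γ τ) → SN (γ x)) →
               ImmediatelyGood (subFrom γ) t → ImmSN (t ⟨ γ ⟩)
  imm-substs : (ts : All (Term F♯ Γ) σs) (γ : Sub F♯ Γ Δ) → GoodArgs (subFrom γ) ts → SNs (substs γ ts)
  imm-subst (var x)    γ h _ = sn-imm _ (h x)
  imm-subst (s · t)    γ h g = g
  imm-subst (lam s)    γ h a = a
  imm-subst (fun f ts) γ h g = imm-substs ts γ g
  imm-substs []       γ _        = sns-[]
  imm-substs (t ∷ ts) γ (g , gs) = sns-∷ g (imm-substs ts γ gs)

  record MinimalInstance {Γ Δ σ} (γ : Sub F♯ Γ Δ) (t : Term F♯ Γ σ) : Set where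
    constructor minimalInstance
    field
      {binders} : Ctx B
      {type}    : Ty B
      cxt       : Cxt F♯ binders type Γ σ
      sub       : Term F♯ (binders ʳ++ Γ) type
      occurs    : t ≡ plug cxt sub
      mnt       : MNT (sub ⟨ liftBelow binders γ ⟩)

  selectInstance : (γ : Sub F♯ Γ Δ) → (∀ {τ} (x : Var Γ τ) → SN (γ x)) → (t : Term F♯ Γ σ) →
                   ¬ SN (t ⟨ γ ⟩) → MinimalInstance γ t
  selectInstance γ h t n with select (subFrom γ) t n
  ... | minimalBad {Θ} C u eq bad min rewrite below-lift Θ γ =
    minimalInstance C u eq (bad , imm-subst u (liftBelow Θ γ) (sn-liftBelow Θ γ h) min)

  -- Weakening undoes the substitution on every variable of `w`, so the instance can be mapped back
  -- to `w` by a substitution, which reflects termination.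
  sn-strengthen : ∀ Θ (w : Term F♯ (Θ ʳ++ (ρ ∷ Γ)) τ) (v : Term F♯ Γ ρ) → ¬ wkBelow Θ zero ∈FV w →
                  SN w → SN (w ⟨ liftBelow Θ (single v) ⟩)
  sn-strengthen {Γ = Γ} Θ w v x∉ a = sn-subst⁻ _ (liftBelow Θ (λ x → var (suc x))) (subst SN (sym back) a)
    where
    retract : RetractExcept zero (single v) (λ x → var (suc x))
    retract zero    = inj₁ refl
    retract (suc y) = inj₂ refl
    at : ∀ {σ} (y : Var (Θ ʳ++ (_ ∷ Γ)) σ) → y ∈FV w →
         liftBelow Θ (single v) y ⟨ liftBelow Θ (λ x → var (suc x)) ⟩ ≡ var y
    at y y∈ with retractBelow Θ zero (single v) (λ x → var (suc x)) retract y
    ... | inj₁ refl = ⊥-elim (x∉ y∈)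
    ... | inj₂ eq   = eq
    back : w ⟨ liftBelow Θ (single v) ⟩ ⟨ liftBelow Θ (λ x → var (suc x)) ⟩ ≡ w
    back = trans (subst-subst w _ _) (trans (subst-coincide w _ var at) (subst-id w))

  single-SN : {v : Term F♯ Γ ρ} → SN v → (x : Var (ρ ∷ Γ) σ) → SN (single v x)
  single-SN a zero    = a
  single-SN a (suc x) = sn-var x

  next-beta : (u : Term F♯ (σ ∷ Γ) τ) (v : Term F♯ Γ σ) → SN u → SN v → ¬ SN (u [ v ]) → Next (lam u · v)
  next-beta u v au av n with selectInstance (single v) (single-SN av) u n
  ... | minimalInstance {Θ} C w refl m@(bad , _) =
    next beta (w ⟨ γ ⟩) m
      (subst (ChainStep 𝒜 beta (lam u · v)) (sym (♯-subst w γ λ x iv → bad (isVar-SN iv)))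
        (beta-sub u v Θ (C , refl) x∈ (λ iv → bad (isVar-SN iv)) (♯-marked w)))
    where
    γ : Sub F♯ _ _
    γ = liftBelow Θ (single v)
    isVar-SN : ∀ {ρ σ} {x : Var _ ρ} {t : Term F♯ _ σ} → IsVar x t → SN (t ⟨ γ ⟩)
    isVar-SN {x = x} var = sn-liftBelow Θ (single v) (single-SN av) x
    x∈ : wkBelow Θ zero ∈FV w
    -- If `x` were absent, the instance of `w` would terminate because `w`, a subterm of `u`, does.
    x∈ = dne λ x∉ → bad (sn-strengthen Θ w v x∉ (sn-plug C w au))

  -- Iteration of the chain construction

  record Successor {Γ σ} (t : Term F♯ Γ σ) : Set where
    constructor successor
    field
      {source} : Term F♯ Γ σ
      inner    : Star (StepIn R♯) (t ♯) source
      outcome  : Next source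

  mnt-successor : Completed 𝒜 → (t : Term F♯ Γ σ) → MNT t → Successor t
  mnt-successor completed t m@(n , i) with headView t
  ... | byVar var     = ⊥-elim (n (sn-var _))
  ... | byVar (app h) = ⊥-elim (n (sn-headVar h (proj₁ i) (proj₂ i)))
  ... | abs s         = ⊥-elim (n (sn-lam i))
  ... | bySym h with expose h m
  ...   | exposed ss i′ (headStep p γ ws refl refl) n′ =
    -- The inner steps were found on the unmarked term; they never touch the root symbol, so they
    -- carry over to the marked one.
    successor (gmap _♯ stepIn-♯ ss) (next-rule p (All.lookup completed p) γ ws i′ n′)
  mnt-successor completed t (n , i) | redex u v [] =
    successor ε (next-beta u v (sn-lam⁻ (proj₁ i)) (proj₂ i)
      (n ∘ sn-beta u v [] (sn-lam⁻ (proj₁ i)) (proj₂ i)))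
  mnt-successor completed t (n , i) | redex u v (w ∷ ws) =
    successor ε (subst Next (sym (♯-·· _ w ws)) (next beta (u [ v ] ·· (w ∷ ws)) m′
      (subst (ChainStep 𝒜 beta _) (sym (♯-·· _ w ws)) (beta-app u v w ws))))
    where
    redex-SN : SN (lam u · v)
    redex-SN = imm-··-head _ w ws i
    m′ : MNT (u [ v ] ·· (w ∷ ws))
    m′ = n ∘ sn-beta u v (w ∷ ws) (sn-lam⁻ (sn-appˡ redex-SN)) (sn-appʳ redex-SN) ,
         imm-··-⟶ w ws (beta refl) i

  record State : Set where
    constructor state
    field
      {ctx}  : Ctx B
      {type} : Ty B
      term   : Term F♯ ctx type
      mnt    : MNT term

  initial : ¬ TerminatingAFS 𝒜 → State
  initial nt with nonterminating nt
  -- At the identity substitution this selects a minimal non-terminating subterm.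
  ... | _ , _ , t , n with selectInstance var sn-var ⌜ t ⌝ (n ∘ subst SN (subst-id ⌜ t ⌝))
  ...   | minimalInstance _ _ _ m = state _ m

  chain : Completed 𝒜 → State → ∃ λ (ch : DependencyChain 𝒜) → Minimal 𝒜 ch
  chain completed q₀ = record
    { label = λ i → Next.label (out i)
    ; ctx   = λ i → State.ctx (q i)
    ; type  = λ i → State.type (q i)
    ; s     = λ i → Successor.source (succ i)
    ; t     = λ i → Next.target (out i) ♯
    ; link  = λ i → Next.link (out i)
    -- State `suc i` holds the target of link `i`, so the inner steps after that link belong to the
    -- next successor. The chain begins at the source of the first link, after the inner steps of
    -- the initial term.
    ; inner = λ i → Successor.inner (succ (suc i))
    } , λ i Θ u occ → sn-terminating (imm-▷ Θ (imm-♯ _ (proj₂ (Next.mnt (out i)))) occ)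
    where
    follow : (q : State) → Successor (State.term q)
    follow q = mnt-successor completed (State.term q) (State.mnt q)
    q : ℕ → State
    q zero    = q₀
    q (suc i) = state (Next.target o) (Next.mnt o)
      where o = Successor.outcome (follow (q i))
    succ : ∀ i → Successor (State.term (q i))
    succ i = follow (q i)
    out : ∀ i → Next (Successor.source (succ i))
    out i = Successor.outcome (succ i)

theorem5p7 : ExcludedMiddle 0ℓ →
    (B : Set) (𝒜 : AFS B) → Completed 𝒜 → ¬ TerminatingAFS 𝒜 →
    ∃ λ (c : DependencyChain 𝒜) → Minimal 𝒜 c
theorem5p7 em B 𝒜 completed nt = chain completed (initial nt)
  where open Reduction em 𝒜
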